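{- Let $\alpha=(\alpha_1,\ldots,\alpha_n)$ and $\beta=(\beta_1,\ldots,\beta_m)$ be compositions of $N$. There is a bijection between $S_{\alpha\beta}$ and the set of semistandard Young tableaux of rectangular shape $(N^m)$ and type $(\alpha,N-\beta)=(\alpha_1,\ldots,\alpha_n,N-\beta_1,\ldots,N-\beta_m)$. Consequently \[ |S_{\alpha\beta}|=\sum_{\lambda\vdash N}K_{\lambda\alpha}K_{\lambda\beta}=K_{(N^m)(\alpha,N-\beta)} . \]
   Context: A composition of $N$ is a finite sequence of nonnegative integers summing to $N$. For compositions $\alpha$ (with $n$ parts) and $\beta$ (with $m$ parts) of $N$, $S_{\alpha\beta}$ is the set of generalized permutations of $\alpha\to\beta$: two-rowed arrays with top row $1^{\alpha_1}2^{\alpha_2}\cdots n^{\alpha_n}$ and bottom row $\tau_{11}\cdots\tau_{1\alpha_1}\cdots\tau_{n1}\cdots\tau_{n\alpha_n}$ with $\tau_{i1}\le\cdots\le\tau_{i\alpha_i}$ for each $i$ and with multiset of bottom entries equal to $\{1^{\beta_1},\ldots,m^{\beta_m}\}$. $K_{\lambda\mu}$ is the Kostka number: the number of semistandard Young tableaux of shape $\lambda$ and type $\mu$ (entry $i$ occurring $\mu_i$ times). $(N^m)$ denotes the shape with $m$ rows each of length $N$. -}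

module Defs where

open import Data.Nat using (ℕ; zero; suc; _<_; _≥_)
open import Data.Fin as Fin using (Fin; zero; suc)
open import Data.Vec as Vec using (Vec; []; _∷_)
open import Data.List as List using (List; []; _∷_; length; concat; filter)
open import Data.List.Relation.Unary.All using (All)
open import Data.List.Relation.Unary.Linked using (Linked)
open import Data.Maybe using (Maybe; just; nothing)
open import Data.Product using (Σ; _×_; _,_; proj₁; proj₂)
open import Relation.Binary.PropositionalEquality using (_≡_)
import Relation.Binary.PropositionalEquality as ≡
open import Relation.Binary.Bundles using (Setoid)
import Relation.Binary.Construct.On as On
open import Level using (0ℓ)
import Data.Nat.ListAction as LA

-- Generalized permutations α → β  (the set S_{αβ})
--
-- A composition α = (α₁,…,αₙ) is a Vec ℕ n.  Letters 1..n are Fin n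
-- (letter i+1 is represented by the Fin value i).

topRow : ∀ {n} (α : Vec ℕ n) → Vec (Fin n) (Vec.sum α)
topRow []      = []
topRow (a ∷ α) = Vec.replicate a zero Vec.++ Vec.map suc (topRow α)

-- A generalized permutation is determined by its bottom row (the top row
-- is fixed by α): within each block of equal top letters the bottom row
-- is weakly increasing, and letter j occurs β_j times in the bottom row.
record GenPerm {n m : ℕ} (α : Vec ℕ n) (β : Vec ℕ m) : Set where
  constructor genPerm
  field
    bottom      : Vec (Fin m) (Vec.sum α)
    blockSorted : ∀ (p q : Fin (Vec.sum α)) → p Fin.≤ q →
                  Vec.lookup (topRow α) p ≡ Vec.lookup (topRow α) q →
                  Vec.lookup bottom p Fin.≤ Vec.lookup bottom q
    content     : ∀ (j : Fin m) → Vec.count (j Fin.≟_) bottom ≡ Vec.lookup β j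

GenPermSetoid : ∀ {n m} (α : Vec ℕ n) (β : Vec ℕ m) → Setoid 0ℓ 0ℓ
GenPermSetoid {n} {m} α β =
  On.setoid {B = GenPerm α β} (≡.setoid (Vec (Fin m) (Vec.sum α))) GenPerm.bottom

nth : {A : Set} → List A → ℕ → Maybe A
nth []       _       = nothing
nth (x ∷ xs) zero    = just x
nth (x ∷ xs) (suc i) = nth xs i

entry : {A : Set} → List (List A) → ℕ → ℕ → Maybe A
entry []       _       c = nothing
entry (row ∷ T) zero    c = nth row c
entry (row ∷ T) (suc r) c = entry T r c

record SSYT {k : ℕ} (shape : List ℕ) (μ : Vec ℕ k) : Set where
  constructor ssyt
  field
    rows      : List (List (Fin k))
    hasShape  : List.map length rows ≡ shape
    rowWeak   : ∀ (r c c' : ℕ) (x y : Fin k) → c < c' →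
                entry rows r c ≡ just x → entry rows r c' ≡ just y → x Fin.≤ y
    colStrict : ∀ (r r' c : ℕ) (x y : Fin k) → r < r' →
                entry rows r c ≡ just x → entry rows r' c ≡ just y → x Fin.< y
    content   : ∀ (i : Fin k) → length (filter (i Fin.≟_) (concat rows)) ≡ Vec.lookup μ i

SSYTSetoid : ∀ {k} (shape : List ℕ) (μ : Vec ℕ k) → Setoid 0ℓ 0ℓ
SSYTSetoid {k} shape μ =
  On.setoid {B = SSYT shape μ} (≡.setoid (List (List (Fin k)))) SSYT.rows

rect : ℕ → ℕ → List ℕ
rect N m = List.replicate m N

record Partition (N : ℕ) : Set where
  constructor partition
  field
    parts      : List ℕ
    positive   : All (0 <_) parts
    decreasing : Linked _≥_ parts
    total      : LA.sum parts ≡ N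

-- The set ⨆_{λ ⊢ N} SSYT(λ, α) × SSYT(λ, β), whose cardinality is
-- Σ_{λ ⊢ N} K_{λα} K_{λβ}.
KostkaPairs : ∀ {n m} (N : ℕ) (α : Vec ℕ n) (β : Vec ℕ m) → Set
KostkaPairs N α β =
  Σ (Partition N) (λ p → SSYT (Partition.parts p) α × SSYT (Partition.parts p) β)

kostkaPairsData : ∀ {n m} {N : ℕ} {α : Vec ℕ n} {β : Vec ℕ m} →
                  KostkaPairs N α β → List ℕ × List (List (Fin n)) × List (List (Fin m))
kostkaPairsData (p , T , U) = Partition.parts p , SSYT.rows T , SSYT.rows U

KostkaPairsSetoid : ∀ {n m} (N : ℕ) (α : Vec ℕ n) (β : Vec ℕ m) → Setoid 0ℓ 0ℓ
KostkaPairsSetoid {n} {m} N α β =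
  On.setoid {B = KostkaPairs N α β}
    (≡.setoid (List ℕ × List (List (Fin n)) × List (List (Fin m)))) kostkaPairsData

{-# OPTIONS --safe #-}
module Submission where

-- All tableaux are encoded as chains of shapes, each a horizontal strip over
-- the previous one.  A generalized permutation is its matrix of multiplicities,
-- with row sums α and column sums β.  RSK is done with local rules: one square
-- of the growth diagram exchanges a matrix entry a and a lower shape ν for an
-- upper shape ρ,
--     ρ₁ = max(λ₁,μ₁) + a,   ρᵢ₊₁ = max(λᵢ₊₁,μᵢ₊₁) + min(λᵢ,μᵢ) − νᵢ,
-- where λ and μ are the two intermediate shapes.  Reading the rows of the matrix
-- in order, the recording tableau is a chain ∅ ⊂ ⋯ ⊂ λ of type α, and
-- the insertion tableau is a Gelfand–Tsetlin pattern with first row λ.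
-- The same pattern can be read in two ways: padded with zeros, its rows form a
-- chain from ∅ to λ; and with i copies of N put in front of the i-th row
-- below λ, they form a chain from λ to the rectangle (Nᵐ), whose steps have
-- sizes N − βⱼ.  In the second reading the parts of β come in the opposite
-- order, so the columns of the matrix are reversed for one of the two bijections.

open import Defs
open import Data.Empty using (⊥; ⊥-elim)
open import Data.Fin as Fin using (Fin; zero; suc)
import Data.Fin.Properties as Fin
open import Data.List as List using (List; []; _∷_; length; concat)
open import Data.List.Properties as List using (drop-map; drop-drop)
open import Data.List.Relation.Unary.All as All using (All; []; _∷_)
open import Data.List.Relation.Unary.AllPairs as AllPairs using (AllPairs; []; _∷_)
import Data.List.Relation.Unary.AllPairs.Properties as AllPairs
open import Data.List.Relation.Unary.Linked using (Linked; []; [-]; _∷_)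
open import Data.List.Relation.Unary.Linked.Properties using (AllPairs⇒Linked; Linked⇒AllPairs)
open import Data.Maybe using (just)
open import Data.Nat
import Data.Nat.ListAction as ListAction
open import Data.Nat.Properties
open import Data.Nat.Tactic.RingSolver using (solve-∀)
open import Data.Product using (_×_; _,_; proj₁; proj₂; ∃)
open import Data.Unit using (⊤; tt)
open import Data.Vec using (Vec; []; _∷_; sum; map; _++_; _∷ʳ_; replicate; zipWith; head; tail; take; drop; init; last; reverse; updateAt; lookup; toList; fromList; count; splitAt)
open import Data.Vec.Properties using (∷-injectiveˡ; ∷-injectiveʳ; map-id; map-∘; map-cong; map-∷ʳ; init-∷ʳ; last-∷ʳ; reverse-∷; reverse-involutive; take++drop≡id; zipWith-assoc; zipWith-comm; zipWith-identityˡ; zipWith-identityʳ; lookup-map; lookup-replicate; lookup∘updateAt; lookup∘updateAt′; tabulate∘lookup; tabulate-cong; toList-++; toList∘fromList; toList-injective; cast-is-id; length-toList)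
open import Function.Bundles using (Inverse)
open import Relation.Binary.PropositionalEquality
import Relation.Binary.PropositionalEquality as ≡
import Relation.Binary.Construct.On as On
open import Relation.Nullary using (¬_; yes; no)

-- All setoids here compare data and forget the proofs, so each step is a pair of plain functions on
-- raw data, inverse to each other only where a validity predicate holds. Records with proof fields
-- appear only at the two ends, through `Image`. The obstacle is inversion. Truncated subtraction is
-- exact in the growth rule only because the shapes interlace, so interlacing travels with every
-- round trip. Undoing the two readings of a pattern requires further that the padding is forced:
-- climbing from the empty shape, a horizontal strip can open at most one new row, which yields the
-- zeros; descending from (Nᵐ), it can break at most one full row, which yields the copies of N.
-- Every shape is a vector of exactly m parts. This loses no partition, since the tableau of type β
-- has letters in `Fin m` and strictly increasing columns.

record PartialBijection {A B : Set} (P : A → Set) (Q : B → Set) : Set where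
  field
    to      : A → B
    from    : B → A
    to-ok   : ∀ {a} → P a → Q (to a)
    from-ok : ∀ {b} → Q b → P (from b)
    from-to : ∀ {a} → P a → from (to a) ≡ a
    to-from : ∀ {b} → Q b → to (from b) ≡ b

infixr 5 _⨾_

_⨾_ : ∀ {A B C : Set} {P : A → Set} {Q : B → Set} {R : C → Set} →
      PartialBijection P Q → PartialBijection Q R → PartialBijection P R
f ⨾ g = record
  { to      = λ a → G.to (F.to a)
  ; from    = λ c → F.from (G.from c)
  ; to-ok   = λ p → G.to-ok (F.to-ok p)
  ; from-ok = λ r → F.from-ok (G.from-ok r)
  ; from-to = λ p → trans (cong F.from (G.from-to (F.to-ok p))) (F.from-to p)
  ; to-from = λ r → trans (cong G.to (F.to-from (G.from-ok r))) (G.to-from r)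
  }
  where
  module F = PartialBijection f
  module G = PartialBijection g

converse : ∀ {A B : Set} {P : A → Set} {Q : B → Set} → PartialBijection P Q → PartialBijection Q P
converse f = record
  { to      = F.from
  ; from    = F.to
  ; to-ok   = F.from-ok
  ; from-ok = F.to-ok
  ; from-to = F.to-from
  ; to-from = F.from-to
  }
  where module F = PartialBijection f

private variable
  k m n : ℕ

-- Vectors of natural numbers and column sums

zeros : Vec ℕ m
zeros {m} = replicate m 0

infixl 6 _⊕_

_⊕_ : Vec ℕ m → Vec ℕ m → Vec ℕ m
_⊕_ = zipWith _+_

columnSums : Vec (Vec ℕ k) m → Vec ℕ k
columnSums []      = zeros
columnSums (v ∷ M) = v ⊕ columnSums M

sum-zeros : ∀ m → sum (zeros {m}) ≡ 0
sum-zeros zero    = refl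
sum-zeros (suc m) = sum-zeros m

sum-⊕ : (u v : Vec ℕ m) → sum (u ⊕ v) ≡ sum u + sum v
sum-⊕ []      []      = refl
sum-⊕ (x ∷ u) (y ∷ v) rewrite sum-⊕ u v = shuffle x y (sum u) (sum v)
  where
  shuffle : ∀ x y s t → x + y + (s + t) ≡ x + s + (y + t)
  shuffle = solve-∀

sum≡0⇒zeros : (v : Vec ℕ m) → sum v ≡ 0 → v ≡ zeros
sum≡0⇒zeros []          _ = refl
sum≡0⇒zeros (zero ∷ v) eq = cong (0 ∷_) (sum≡0⇒zeros v eq)

⊕-assoc : (u v w : Vec ℕ m) → u ⊕ v ⊕ w ≡ u ⊕ (v ⊕ w)
⊕-assoc = zipWith-assoc +-assoc

⊕-comm : (u v : Vec ℕ m) → u ⊕ v ≡ v ⊕ u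
⊕-comm = zipWith-comm +-comm

⊕-identityˡ : (v : Vec ℕ m) → zeros ⊕ v ≡ v
⊕-identityˡ = zipWith-identityˡ +-identityˡ

⊕-identityʳ : (v : Vec ℕ m) → v ⊕ zeros ≡ v
⊕-identityʳ = zipWith-identityʳ +-identityʳ

-- Horizontal strips and chains of shapes

hd : Vec ℕ m → ℕ
hd []      = 0
hd (x ∷ _) = x

-- λ₁ ≥ ν₁ ≥ λ₂ ≥ ν₂ ≥ ⋯ : both are partitions and λ/ν is a horizontal strip.
Strip : Vec ℕ m → Vec ℕ m → Set
Strip []       []       = ⊤
Strip (l ∷ ls) (v ∷ vs) = v ≤ l × hd ls ≤ v × Strip ls vs

-- Chains λ⁰ ⊂ λ¹ ⊂ ⋯ ⊂ λᵏ of shapes are stored as the vector of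
-- λ⁰, …, λᵏ⁻¹, separately from the top shape λᵏ.
bottomShape : Vec (Vec ℕ m) k → Vec ℕ m → Vec ℕ m
bottomShape []      hi = hi
bottomShape (c ∷ _) _  = c

Chain : Vec ℕ k → Vec (Vec ℕ m) k → Vec ℕ m → Set
Chain []      []       hi = ⊤
Chain (a ∷ α) (c ∷ cs) hi =
  Strip (bottomShape cs hi) c × sum (bottomShape cs hi) ≡ sum c + a × Chain α cs hi

-- Gelfand–Tsetlin patterns and the growth rule

Triangle : ℕ → Set
Triangle zero    = ⊤
Triangle (suc m) = Vec ℕ (suc m) × Triangle m

top : Triangle m → Vec ℕ m
top {zero}  _       = []
top {suc m} (ρ , _) = ρ

-- The first part of the type is the size difference of the two longest rows.
Pattern : Vec ℕ m → Triangle m → Set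
Pattern []      _       = ⊤
Pattern (b ∷ β) (ρ , t) = Strip ρ (top t ∷ʳ 0) × sum ρ ≡ sum (top t) + b × Pattern β t

zeroTriangle : ∀ m → Triangle m
zeroTriangle zero    = tt
zeroTriangle (suc m) = zeros , zeroTriangle m

-- The arguments are a, ν, μ, λ in this order. The number x is the matrix entry at the first part
-- and afterwards the carry min - ν coming from the part above, so one clause covers both formulas
-- of the rule. The missing last part of λ counts as 0.
grow : ℕ → Vec ℕ m → Vec ℕ (suc m) → Vec ℕ m → Vec ℕ (suc m)
grow x []       (u ∷ _)  []       = u + x ∷ []
grow x (v ∷ vs) (u ∷ us) (l ∷ ls) = (l ⊔ u) + x ∷ grow (l ⊓ u ∸ v) vs us ls

-- The carries are recovered from the last part upwards: `y` is the carry that left the current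
-- part, so the part of ν is l ⊓ u - y.
shrink : Vec ℕ (suc m) → Vec ℕ (suc m) → Vec ℕ m → ℕ × Vec ℕ m
shrink (r ∷ _)  (u ∷ _)  []       = r ∸ u , []
shrink (r ∷ rs) (u ∷ us) (l ∷ ls) =
  let (y , vs) = shrink rs us ls in r ∸ (l ⊔ u) , (l ⊓ u ∸ y) ∷ vs

-- Interlacing bounds the next parts of λ and μ by the current part v of ν. Their maximum plus the
-- carry l ⊓ u - v is therefore at most l ⊓ u, which is what both strips ask of the next part of ρ.
grow-strips : ∀ x (vs : Vec ℕ m) us ls → Strip us (vs ∷ʳ 0) → Strip ls vs →
  Strip (grow x vs us ls) (ls ∷ʳ 0) × Strip (grow x vs us ls) us
grow-strips x [] (u ∷ []) [] _ _ = (z≤n , z≤n , tt) , (m≤m+n u x , z≤n , tt)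
grow-strips {suc m} x (v ∷ vs) (u ∷ us) (l ∷ ls) (v≤u , us≤v , A) (v≤l , ls≤v , B)
  with grow-strips (l ⊓ u ∸ v) vs us ls A B
... | C , D = (≤-trans (m≤m⊔n l u) (m≤m+n _ x) , ≤-trans bound (m⊓n≤m l u) , C)
            , (≤-trans (m≤n⊔m l u) (m≤m+n _ x) , ≤-trans bound (m⊓n≤n l u) , D)
  where
  open ≤-Reasoning
  hd-grow : ∀ {m} x (vs : Vec ℕ m) us ls → hd (grow x vs us ls) ≡ (hd ls ⊔ hd us) + x
  hd-grow x []       (u ∷ []) []       = refl
  hd-grow x (v ∷ vs) (u ∷ us) (l ∷ ls) = refl
  bound : hd (grow (l ⊓ u ∸ v) vs us ls) ≤ l ⊓ u
  bound = begin
    hd (grow (l ⊓ u ∸ v) vs us ls)    ≡⟨ hd-grow (l ⊓ u ∸ v) vs us ls ⟩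
    (hd ls ⊔ hd us) + (l ⊓ u ∸ v)     ≤⟨ +-monoˡ-≤ _ (⊔-lub ls≤v us≤v) ⟩
    v + (l ⊓ u ∸ v)                   ≡⟨ m+[n∸m]≡n (⊓-glb v≤l v≤u) ⟩
    l ⊓ u ∎

shrink-grow : ∀ x (vs : Vec ℕ m) us ls → Strip us (vs ∷ʳ 0) → Strip ls vs →
  shrink (grow x vs us ls) us ls ≡ (x , vs)
shrink-grow x [] (u ∷ []) [] _ _ = cong (_, []) (m+n∸m≡n u x)
shrink-grow {suc m} x (v ∷ vs) (u ∷ us) (l ∷ ls) (v≤u , _ , A) (v≤l , _ , B)
  rewrite shrink-grow (l ⊓ u ∸ v) vs us ls A B =
  cong₂ (λ y w → y , w ∷ vs) (m+n∸m≡n (l ⊔ u) x) (m∸[m∸n]≡n (⊓-glb v≤l v≤u))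

-- Both strips bound the first parts of λ and μ by that of ρ, so the subtraction that computes the
-- carry is exact. In this additive form it also shows that a recovered part of ν is at least the
-- next parts of λ and μ.
shrink-carry : ∀ rs us (ls : Vec ℕ m) → Strip rs (ls ∷ʳ 0) → Strip rs us →
  (hd ls ⊔ hd us) + proj₁ (shrink rs us ls) ≡ hd rs
shrink-carry (r ∷ []) (u ∷ []) []       _         (u≤r , _) = m+[n∸m]≡n u≤r
shrink-carry (r ∷ rs) (u ∷ us) (l ∷ ls) (l≤r , _) (u≤r , _) = m+[n∸m]≡n (⊔-lub l≤r u≤r)

-- This bound makes the truncated subtraction l ⊓ u ∸ y in shrink exact.
shrink-carry-≤ : ∀ {b} rs us (ls : Vec ℕ m) → Strip rs (ls ∷ʳ 0) → Strip rs us →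
  hd rs ≤ b → proj₁ (shrink rs us ls) ≤ b
shrink-carry-≤ rs us ls A B le =
  ≤-trans (m≤n+m _ (hd ls ⊔ hd us)) (≤-trans (≤-reflexive (shrink-carry rs us ls A B)) le)

shrink-strips : ∀ rs us (ls : Vec ℕ m) → Strip rs (ls ∷ʳ 0) → Strip rs us →
  Strip us (proj₂ (shrink rs us ls) ∷ʳ 0) × Strip ls (proj₂ (shrink rs us ls))
shrink-strips (r ∷ []) (u ∷ []) [] _ _ = (z≤n , z≤n , tt) , tt
shrink-strips {suc m} (r ∷ rs) (u ∷ us) (l ∷ ls) (l≤r , rs≤l , A) (u≤r , rs≤u , B)
  with shrink-strips rs us ls A B
... | C , D = (≤-trans (m∸n≤m _ y) (m⊓n≤n l u) , ≤-trans (m≤n⊔m _ _) bound , C)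
            , (≤-trans (m∸n≤m _ y) (m⊓n≤m l u) , ≤-trans (m≤m⊔n _ _) bound , D)
  where
  y = proj₁ (shrink rs us ls)
  bound : hd ls ⊔ hd us ≤ l ⊓ u ∸ y
  bound = m+n≤o⇒m≤o∸n _ (≤-trans (≤-reflexive (shrink-carry rs us ls A B)) (⊓-glb rs≤l rs≤u))

grow-shrink : ∀ rs us (ls : Vec ℕ m) → Strip rs (ls ∷ʳ 0) → Strip rs us →
  grow (proj₁ (shrink rs us ls)) (proj₂ (shrink rs us ls)) us ls ≡ rs
grow-shrink (r ∷ []) (u ∷ []) [] _ (u≤r , _) = cong (_∷ []) (m+[n∸m]≡n u≤r)
grow-shrink {suc m} (r ∷ rs) (u ∷ us) (l ∷ ls) (l≤r , rs≤l , A) (u≤r , rs≤u , B) =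
  cong₂ _∷_ (m+[n∸m]≡n (⊔-lub l≤r u≤r))
    (trans (cong (λ x → grow x (proj₂ (shrink rs us ls)) us ls)
             (m∸[m∸n]≡n (shrink-carry-≤ rs us ls A B (⊓-glb rs≤l rs≤u))))
           (grow-shrink rs us ls A B))

-- Max and min of a pair add up to its sum, and the carry leaving one part enters the next, so of
-- all carries only the first one, x, remains. Along one side of the square this identity controls
-- the column sums of the matrix, along the other the row sums.
sum-grow : ∀ x (vs : Vec ℕ m) us ls → Strip us (vs ∷ʳ 0) → Strip ls vs →
  sum (grow x vs us ls) + sum vs ≡ sum ls + sum us + x
sum-grow x [] (u ∷ []) [] _ _ = shuffle u x
  where
  shuffle : ∀ u x → u + x + 0 + 0 ≡ u + 0 + x
  shuffle = solve-∀
sum-grow {suc m} x (v ∷ vs) (u ∷ us) (l ∷ ls) (v≤u , _ , A) (v≤l , _ , B) = begin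
  (l ⊔ u) + x + G + (v + V)               ≡⟨ shuffle₁ (l ⊔ u) x G v V ⟩
  (l ⊔ u) + x + v + (G + V)               ≡⟨ cong ((l ⊔ u) + x + v +_) (sum-grow _ vs us ls A B) ⟩
  (l ⊔ u) + x + v + (L + U + (l ⊓ u ∸ v)) ≡⟨ shuffle₂ (l ⊔ u) x v (L + U) (l ⊓ u ∸ v) ⟩
  (l ⊔ u) + (v + (l ⊓ u ∸ v)) + (L + U) + x
    ≡⟨ cong (λ w → (l ⊔ u) + w + (L + U) + x) (m+[n∸m]≡n (⊓-glb v≤l v≤u)) ⟩
  (l ⊔ u) + (l ⊓ u) + (L + U) + x         ≡⟨ cong (λ w → w + (L + U) + x) (max+min l u) ⟩
  l + u + (L + U) + x                     ≡⟨ shuffle₃ l u L U x ⟩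
  l + L + (u + U) + x                     ∎
  where
  open ≡-Reasoning
  G = sum (grow (l ⊓ u ∸ v) vs us ls)
  V = sum vs
  L = sum ls
  U = sum us
  shuffle₁ : ∀ a x g v w → a + x + g + (v + w) ≡ a + x + v + (g + w)
  shuffle₁ = solve-∀
  shuffle₂ : ∀ a x v s y → a + x + v + (s + y) ≡ a + (v + y) + s + x
  shuffle₂ = solve-∀
  shuffle₃ : ∀ l u s t x → l + u + (s + t) + x ≡ l + s + (u + t) + x
  shuffle₃ = solve-∀
  max+min : ∀ l u → (l ⊔ u) + (l ⊓ u) ≡ l + u
  max+min zero    u       = +-identityʳ u
  max+min (suc l) zero    = refl
  max+min (suc l) (suc u) rewrite +-suc (l ⊔ u) (l ⊓ u) | +-suc l u = cong (λ w → 2 + w) (max+min l u)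

-- Row insertion of RSK, in terms of Gelfand–Tsetlin patterns

insert : Vec ℕ m → Triangle m → Triangle m
insert []       t       = tt
insert (a ∷ as) (μ , t) = grow a (top t) μ (top (insert as t)) , insert as t

-- The vector argument is the longest row before the insertion.
uninsert : Vec ℕ m → Triangle m → Vec ℕ m × Triangle m
uninsert []           t       = [] , tt
uninsert μ@(_ ∷ _) (ρ , t) =
  let (a , ν)   = shrink ρ μ (top t)
      (as , t₀) = uninsert ν t
  in a ∷ as , μ , t₀

-- The middle conclusion drives the induction: the strip between the old and the new longest row of
-- the smaller pattern is a side of the next square. For the whole pattern it becomes a step of the
-- recording chain.
insert-ok : ∀ {β : Vec ℕ m} as t → Pattern β t →
  Pattern (as ⊕ β) (insert as t) × Strip (top (insert as t)) (top t) ×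
  sum (top (insert as t)) ≡ sum (top t) + sum as
insert-ok {β = []}    []       t       _           = tt , tt , refl
insert-ok {β = b ∷ β} (a ∷ as) (μ , t) (A , s , P)
  with insert-ok as t P
... | P′ , B , s′ with grow-strips a (top t) μ (top (insert as t)) A B
... | C , D = (C , size , P′) , D , size′
  where
  t′ = insert as t
  ρ  = grow a (top t) μ (top t′)
  eq : sum ρ + sum (top t) ≡ sum (top t′) + sum μ + a
  eq = sum-grow a (top t) μ (top t′) A B
  open ≡-Reasoning
  size : sum ρ ≡ sum (top t′) + (a + b)
  size = +-cancelʳ-≡ (sum (top t)) _ _ (begin
    sum ρ + sum (top t)                  ≡⟨ eq ⟩
    sum (top t′) + sum μ + a             ≡⟨ cong (λ z → sum (top t′) + z + a) s ⟩
    sum (top t′) + (sum (top t) + b) + a ≡⟨ shuffle (sum (top t′)) (sum (top t)) b a ⟩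
    sum (top t′) + (a + b) + sum (top t) ∎)
    where
    shuffle : ∀ x y b a → x + (y + b) + a ≡ x + (a + b) + y
    shuffle = solve-∀
  size′ : sum ρ ≡ sum μ + (a + sum as)
  size′ = +-cancelʳ-≡ (sum (top t)) _ _ (begin
    sum ρ + sum (top t)                  ≡⟨ eq ⟩
    sum (top t′) + sum μ + a             ≡⟨ cong (λ z → z + sum μ + a) s′ ⟩
    sum (top t) + sum as + sum μ + a     ≡⟨ shuffle (sum (top t)) (sum as) (sum μ) a ⟩
    sum μ + (a + sum as) + sum (top t)   ∎)
    where
    shuffle : ∀ x s u a → x + s + u + a ≡ u + (a + s) + x
    shuffle = solve-∀

uninsert-insert : ∀ {β : Vec ℕ m} as t → Pattern β t →
  uninsert (top t) (insert as t) ≡ (as , t)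
uninsert-insert {β = []}    []       t             _           = refl
uninsert-insert {β = b ∷ β} (a ∷ as) (μ@(_ ∷ _) , t) (A , _ , P)
  with insert-ok as t P
... | _ , B , _
  rewrite shrink-grow a (top t) μ (top (insert as t)) A B
        | uninsert-insert as t P = refl

top-uninsert : (μ : Vec ℕ m) (t : Triangle m) → top (proj₂ (uninsert μ t)) ≡ μ
top-uninsert []      t = refl
top-uninsert (_ ∷ _) t = refl

insert-uninsert : ∀ {β : Vec ℕ m} μ t → Pattern β t → Strip (top t) μ →
  insert (proj₁ (uninsert μ t)) (proj₂ (uninsert μ t)) ≡ t
insert-uninsert {β = []}    []          t       _           _ = refl
insert-uninsert {β = b ∷ β} μ@(_ ∷ _) (ρ , t) (A , _ , P) B
  with shrink-strips ρ μ (top t) A B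
... | _ , D
  rewrite insert-uninsert (proj₂ (shrink ρ μ (top t))) t P D
        | top-uninsert (proj₂ (shrink ρ μ (top t))) t
        | grow-shrink ρ μ (top t) A B = refl

uninsert-ok : ∀ {β : Vec ℕ m} μ t → Pattern β t → Strip (top t) μ →
  ∃ λ β₀ → Pattern β₀ (proj₂ (uninsert μ t)) × proj₁ (uninsert μ t) ⊕ β₀ ≡ β
uninsert-ok {β = []}    []          t       _           _ = [] , tt , refl
uninsert-ok {β = b ∷ β} μ@(_ ∷ _) (ρ , t) (A , s , P) B
  with shrink-strips ρ μ (top t) A B
... | C , D with uninsert-ok (proj₂ (shrink ρ μ (top t))) t P D
-- The first part of the old type can only be the size of μ/ν, where μ and ν are the two longest
-- rows before the insertion.
... | β₀ , P₀ , eq = (sum μ ∸ sum ν) ∷ β₀ , (C′ , sym size , P₀) , cong₂ _∷_ size′ eq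
  where
  a = proj₁ (shrink ρ μ (top t))
  ν = proj₂ (shrink ρ μ (top t))
  t₀ = proj₂ (uninsert ν t)
  C′ : Strip μ (top t₀ ∷ʳ 0)
  C′ = subst (λ z → Strip μ (z ∷ʳ 0)) (sym (top-uninsert ν t)) C
  ν≤μ : ∀ {m} (us : Vec ℕ (suc m)) vs → Strip us (vs ∷ʳ 0) → sum vs ≤ sum us
  ν≤μ us       []       _           = z≤n
  ν≤μ (u ∷ us) (v ∷ vs) (le , _ , S) = +-mono-≤ le (ν≤μ us vs S)
  size : sum (top t₀) + (sum μ ∸ sum ν) ≡ sum μ
  size = trans (cong (λ z → sum z + (sum μ ∸ sum ν)) (top-uninsert ν t)) (m+[n∸m]≡n (ν≤μ μ ν C))
  total : sum ρ + sum ν ≡ sum (top t) + sum μ + a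
  total = trans (cong (λ z → sum z + sum ν) (sym (grow-shrink ρ μ (top t) A B)))
                (sum-grow a ν μ (top t) C D)
  open ≡-Reasoning
  size′ : a + (sum μ ∸ sum ν) ≡ b
  size′ = +-cancelˡ-≡ (sum (top t) + sum ν) _ _ (begin
    sum (top t) + sum ν + (a + (sum μ ∸ sum ν)) ≡⟨ shuffle₁ (sum (top t)) (sum ν) a (sum μ ∸ sum ν) ⟩
    sum (top t) + (sum ν + (sum μ ∸ sum ν)) + a ≡⟨ cong (λ z → sum (top t) + z + a) (m+[n∸m]≡n (ν≤μ μ ν C)) ⟩
    sum (top t) + sum μ + a                     ≡⟨ sym total ⟩
    sum ρ + sum ν                               ≡⟨ cong (_+ sum ν) s ⟩
    sum (top t) + b + sum ν                     ≡⟨ shuffle₂ (sum (top t)) b (sum ν) ⟩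
    sum (top t) + sum ν + b                     ∎)
    where
    shuffle₁ : ∀ x v a d → x + v + (a + d) ≡ x + (v + d) + a
    shuffle₁ = solve-∀
    shuffle₂ : ∀ x b v → x + b + v ≡ x + v + b
    shuffle₂ = solve-∀

-- Insertion of all rows of a matrix

run : Triangle m → Vec (Vec ℕ m) n → Vec (Vec ℕ m) n × Triangle m
run t []      = [] , t
run t (a ∷ A) = let (cs , t′) = run (insert a t) A in top t ∷ cs , t′

unrun : Vec (Vec ℕ m) n → Triangle m → Triangle m × Vec (Vec ℕ m) n
unrun []       t = t , []
unrun (c ∷ cs) t =
  let (t₁ , A)  = unrun cs t
      (a , t₀) = uninsert c t₁
  in t₀ , a ∷ A

run-ok : ∀ {β : Vec ℕ m} t (A : Vec (Vec ℕ m) n) → Pattern β t →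
  let (cs , t′) = run t A in
  bottomShape cs (top t′) ≡ top t × Chain (map sum A) cs (top t′) × Pattern (β ⊕ columnSums A) t′
run-ok {β = β} t [] P = refl , tt , subst (λ z → Pattern z t) (sym (⊕-identityʳ β)) P
run-ok {β = β} t (a ∷ A) P with insert-ok a t P
... | P₁ , S , s with run-ok (insert a t) A P₁
... | b , C , P′ =
  refl ,
  (subst (λ z → Strip z (top t)) (sym b) S , trans (cong sum b) s , C) ,
  subst (λ z → Pattern z (proj₂ (run t (a ∷ A))))
    (trans (cong (_⊕ columnSums A) (⊕-comm a β)) (⊕-assoc β a (columnSums A))) P′

unrun-run : ∀ {β : Vec ℕ m} t (A : Vec (Vec ℕ m) n) → Pattern β t →
  unrun (proj₁ (run t A)) (proj₂ (run t A)) ≡ (t , A)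
unrun-run t []      P = refl
unrun-run t (a ∷ A) P
  rewrite unrun-run (insert a t) A (proj₁ (insert-ok a t P))
        | uninsert-insert a t P = refl

unrun-ok : ∀ {α : Vec ℕ n} {β : Vec ℕ m} cs t → Chain α cs (top t) → Pattern β t →
  let (t₀ , A) = unrun cs t in
  (∃ λ β₀ → Pattern β₀ t₀ × β₀ ⊕ columnSums A ≡ β) ×
  map sum A ≡ α × top t₀ ≡ bottomShape cs (top t)
unrun-ok {α = []} {β} [] t _ P = (β , P , ⊕-identityʳ β) , refl , refl
unrun-ok {α = a ∷ α} {β} (c ∷ cs) t (S , s , C) P
  with unrun-ok cs t C P
... | (β₁ , P₁ , eq₁) , rows , top₁ with uninsert-ok c t₁ P₁ S₁
  where
  t₁ = proj₁ (unrun cs t)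
  S₁ = subst (λ z → Strip z c) (sym top₁) S
... | β₀ , P₀ , eq₀ =
  (β₀ , P₀ , columns) , cong₂ _∷_ row rows , top-uninsert c t₁
  where
  t₁ = proj₁ (unrun cs t)
  A  = proj₂ (unrun cs t)
  x  = proj₁ (uninsert c t₁)
  t₀ = proj₂ (uninsert c t₁)
  S₁ = subst (λ z → Strip z c) (sym top₁) S
  open ≡-Reasoning
  columns : β₀ ⊕ (x ⊕ columnSums A) ≡ β
  columns = begin
    β₀ ⊕ (x ⊕ columnSums A) ≡⟨ ⊕-assoc β₀ x (columnSums A) ⟨
    β₀ ⊕ x ⊕ columnSums A   ≡⟨ cong (_⊕ columnSums A) (trans (⊕-comm β₀ x) eq₀) ⟩
    β₁ ⊕ columnSums A       ≡⟨ eq₁ ⟩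
    β                       ∎
  -- Inserting `x` again leads back to the undone pattern `proj₁ (unrun cs t)`, so the size that
  -- this insertion adds is the size of the chain step.
  row : sum x ≡ a
  row = +-cancelˡ-≡ (sum c) _ _ (begin
    sum c + sum x                ≡⟨ cong (λ z → sum z + sum x) (top-uninsert c t₁) ⟨
    sum (top t₀) + sum x         ≡⟨ proj₂ (proj₂ (insert-ok x t₀ P₀)) ⟨
    sum (top (insert x t₀))      ≡⟨ cong (λ z → sum (top z)) (insert-uninsert c t₁ P₁ S₁) ⟩
    sum (top t₁)                 ≡⟨ cong sum top₁ ⟩
    sum (bottomShape cs (top t)) ≡⟨ s ⟩
    sum c + a                    ∎)

run-unrun : ∀ {α : Vec ℕ n} {β : Vec ℕ m} cs t → Chain α cs (top t) → Pattern β t →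
  run (proj₁ (unrun cs t)) (proj₂ (unrun cs t)) ≡ (cs , t)
run-unrun {α = []} [] t _ _ = refl
run-unrun {α = a ∷ α} (c ∷ cs) t (S , s , C) P
  with unrun-ok cs t C P
... | (β₁ , P₁ , _) , _ , top₁
  rewrite insert-uninsert c (proj₁ (unrun cs t)) P₁ (subst (λ z → Strip z c) (sym top₁) S)
        | run-unrun cs t C P
        | top-uninsert c (proj₁ (unrun cs t)) = refl

-- The empty pattern and the RSK bijection

zeros-strip : ∀ m → Strip (zeros {m}) zeros
zeros-strip zero          = tt
zeros-strip (suc zero)    = z≤n , z≤n , tt
zeros-strip (suc (suc m)) = z≤n , z≤n , zeros-strip (suc m)

zeros-∷ʳ : ∀ m → zeros {m} ∷ʳ 0 ≡ zeros
zeros-∷ʳ zero    = refl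
zeros-∷ʳ (suc m) = cong (0 ∷_) (zeros-∷ʳ m)

top-zeroTriangle : ∀ m → top (zeroTriangle m) ≡ zeros
top-zeroTriangle zero    = refl
top-zeroTriangle (suc m) = refl

zeroTriangle-pattern : ∀ m → Pattern zeros (zeroTriangle m)
zeroTriangle-pattern zero    = tt
zeroTriangle-pattern (suc m) rewrite top-zeroTriangle m | zeros-∷ʳ m =
  zeros-strip (suc m) , sym (+-identityʳ _) , zeroTriangle-pattern m

-- Row sizes weakly increase with the length of the row, so an empty longest row empties all others.
-- Undoing RSK down to the empty shape thus leaves nothing behind, and the column sums of the matrix
-- account for all of β.
pattern-zeroTriangle : ∀ {β : Vec ℕ m} t → Pattern β t → top t ≡ zeros →
  t ≡ zeroTriangle m × β ≡ zeros
pattern-zeroTriangle {β = []} tt _ _ = refl , refl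
pattern-zeroTriangle {suc m} {β = b ∷ β} (ρ , t) (_ , s , P) refl
  with pattern-zeroTriangle t P (sum≡0⇒zeros (top t) (m+n≡0⇒m≡0 _ total))
  where
  total : sum (top t) + b ≡ 0
  total = trans (sym s) (sum-zeros m)
... | refl , refl = refl , cong (_∷ zeros) (m+n≡0⇒n≡0 (sum (top t)) (trans (sym s) (sum-zeros m)))

MatrixOf : Vec ℕ n → Vec ℕ m → Vec (Vec ℕ m) n → Set
MatrixOf α β M = map sum M ≡ α × columnSums M ≡ β

ChainFrom0 : Vec ℕ k → Vec ℕ m → Vec (Vec ℕ m) k → Set
ChainFrom0 α hi cs = bottomShape cs hi ≡ zeros × Chain α cs hi

ChainPattern : Vec ℕ n → Vec ℕ m → Vec (Vec ℕ m) n × Triangle m → Set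
ChainPattern α β (cs , t) = ChainFrom0 α (top t) cs × Pattern β t

rsk : (α : Vec ℕ n) (β : Vec ℕ m) → PartialBijection (MatrixOf α β) (ChainPattern α β)
rsk {m = m} α β = record
  { to      = run t₀
  ; from    = λ (cs , t) → proj₂ (unrun cs t)
  ; to-ok   = to-ok _
  ; from-ok = λ {(cs , t)} → from-ok cs t
  ; from-to = λ _ → cong proj₂ (unrun-run t₀ _ (zeroTriangle-pattern m))
  ; to-from = λ {(cs , t)} → to-from cs t
  }
  where
  t₀ = zeroTriangle m
  to-ok : ∀ M → MatrixOf α β M → ChainPattern α β (run t₀ M)
  to-ok M (refl , refl) with run-ok t₀ M (zeroTriangle-pattern m)
  ... | b , C , P = (trans b (top-zeroTriangle m) , C) ,
                    subst (λ z → Pattern z (proj₂ (run t₀ M))) (⊕-identityˡ (columnSums M)) P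
  start : ∀ cs t → ChainPattern α β (cs , t) →
          MatrixOf α β (proj₂ (unrun cs t)) × proj₁ (unrun cs t) ≡ t₀
  start cs t ((b , C) , P) with unrun-ok cs t C P
  ... | (β₀ , P₀ , columns) , rows , top₀ with pattern-zeroTriangle _ P₀ (trans top₀ b)
  ... | eq , refl = (rows , trans (sym (⊕-identityˡ _)) columns) , eq
  from-ok : ∀ cs t → ChainPattern α β (cs , t) → MatrixOf α β (proj₂ (unrun cs t))
  from-ok cs t CP = proj₁ (start cs t CP)
  to-from : ∀ cs t → ChainPattern α β (cs , t) → run t₀ (proj₂ (unrun cs t)) ≡ (cs , t)
  to-from cs t CP@((_ , C) , P) =
    trans (cong (λ z → run z (proj₂ (unrun cs t))) (sym (proj₂ (start cs t CP)))) (run-unrun cs t C P)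

-- Concatenation, size and first parts of chains

bottomShape-map : (f : Vec ℕ m → Vec ℕ n) (cs : Vec (Vec ℕ m) k) (hi : Vec ℕ m) →
  bottomShape (map f cs) (f hi) ≡ f (bottomShape cs hi)
bottomShape-map f []      hi = refl
bottomShape-map f (_ ∷ _) hi = refl

bottomShape-++ : (cs : Vec (Vec ℕ m) n) (ds : Vec (Vec ℕ m) k) (hi : Vec ℕ m) →
  bottomShape (cs ++ ds) hi ≡ bottomShape cs (bottomShape ds hi)
bottomShape-++ []      ds hi = refl
bottomShape-++ (_ ∷ _) ds hi = refl

chain-++⁺ : ∀ {α : Vec ℕ n} {γ : Vec ℕ k} (cs : Vec (Vec ℕ m) n) ds {hi} →
  Chain α cs (bottomShape ds hi) → Chain γ ds hi → Chain (α ++ γ) (cs ++ ds) hi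
chain-++⁺ {α = []}    []       ds C           D = D
chain-++⁺ {α = _ ∷ _} (c ∷ cs) ds {hi} (S , s , C) D =
  subst (λ z → Strip z c) (sym (bottomShape-++ cs ds hi)) S ,
  trans (cong sum (bottomShape-++ cs ds hi)) s ,
  chain-++⁺ cs ds C D

chain-++⁻ : ∀ (α : Vec ℕ n) {γ : Vec ℕ k} (cs : Vec (Vec ℕ m) n) ds {hi} →
  Chain (α ++ γ) (cs ++ ds) hi → Chain α cs (bottomShape ds hi) × Chain γ ds hi
chain-++⁻ []      []       ds D                = tt , D
chain-++⁻ (_ ∷ α) (c ∷ cs) ds {hi} (S , s , C) with chain-++⁻ α cs ds C
... | C′ , D =
  (subst (λ z → Strip z c) (bottomShape-++ cs ds hi) S ,
   trans (cong sum (sym (bottomShape-++ cs ds hi))) s , C′) , D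

chain-sum : ∀ {α : Vec ℕ k} (cs : Vec (Vec ℕ m) k) {hi} → Chain α cs hi →
  sum hi ≡ sum (bottomShape cs hi) + sum α
chain-sum {α = []}    []       _           = sym (+-identityʳ _)
chain-sum {α = a ∷ α} (c ∷ cs) (_ , s , C) =
  trans (chain-sum cs C) (trans (cong (_+ sum α) s) (+-assoc (sum c) a (sum α)))

chainFrom0-sum : ∀ {α : Vec ℕ k} (cs : Vec (Vec ℕ m) k) {hi} → ChainFrom0 α hi cs → sum hi ≡ sum α
chainFrom0-sum {m = m} {α} cs (b , C) =
  trans (chain-sum cs C) (cong (_+ sum α) (trans (cong sum b) (sum-zeros m)))

strip-hd : (ls vs : Vec ℕ m) → Strip ls vs → hd vs ≤ hd ls
strip-hd []      []      _        = z≤n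
strip-hd (_ ∷ _) (_ ∷ _) (le , _) = le

chain-hd : ∀ {α : Vec ℕ k} (cs : Vec (Vec ℕ m) k) {hi} → Chain α cs hi →
  hd (bottomShape cs hi) ≤ hd hi
chain-hd {α = []}    []       _           = ≤-refl
chain-hd {α = _ ∷ _} (c ∷ cs) (S , _ , C) = ≤-trans (strip-hd _ c S) (chain-hd cs C)

hd≤sum : (v : Vec ℕ m) → hd v ≤ sum v
hd≤sum []      = z≤n
hd≤sum (x ∷ v) = m≤m+n x (sum v)

-- The interlacing ρ₁ ≥ v₁ ≥ ρ₂ ≥ ⋯ becomes N ≥ ρ₁ ≥ v₁ ≥ ⋯, so that the inner shape, with N in
-- front, turns into the outer one. Only ρ₁ ≤ N is new.
strip-shift⁺ : ∀ {N} ρ (v : Vec ℕ m) → hd ρ ≤ N → Strip ρ (v ∷ʳ 0) → Strip (N ∷ v) ρ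
strip-shift⁺ (r ∷ []) []      le _            = le , z≤n , tt
strip-shift⁺ (r ∷ rs) (x ∷ v) le (x≤r , rs≤x , S) = le , x≤r , strip-shift⁺ rs v rs≤x S

strip-shift⁻ : ∀ {N} ρ (v : Vec ℕ m) → Strip (N ∷ v) ρ → Strip ρ (v ∷ʳ 0)
strip-shift⁻ (r ∷ [])       []      _                = z≤n , z≤n , tt
strip-shift⁻ (r ∷ rs@(_ ∷ _)) (x ∷ v) (_ , x≤r , S@(rs≤x , _)) = x≤r , rs≤x , strip-shift⁻ rs v S

-- Completing a pattern to a chain up to a rectangle

module Rectangle (N : ℕ) where

  full : ∀ m → Vec ℕ m
  full m = replicate m N

  hd-full : ∀ m → hd (full m) ≤ N
  hd-full zero    = z≤n
  hd-full (suc m) = ≤-refl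

  -- In a chain up to the rectangle (Nᵐ), the shape i steps below the top has
  -- its first m − i rows full; the other i form the row of length i of a pattern.
  complete : Triangle m → Vec (Vec ℕ m) m
  complete {zero}  _       = []
  complete {suc m} (ρ , t) = ρ ∷ map (N ∷_) (complete t)

  uncomplete : Vec (Vec ℕ m) m → Triangle m
  uncomplete {zero}  _        = tt
  uncomplete {suc m} (ρ ∷ cs) = ρ , uncomplete (map tail cs)

  bottomShape-complete : (t : Triangle m) → bottomShape (complete t) (full m) ≡ top t
  bottomShape-complete {zero}  t = refl
  bottomShape-complete {suc m} t = refl

  chain-cons⁺ : ∀ {γ : Vec ℕ k} (cs : Vec (Vec ℕ m) k) {hi} → hd hi ≤ N →
    Chain γ cs hi → Chain γ (map (N ∷_) cs) (N ∷ hi)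
  chain-cons⁺ {γ = []}    []       le _           = tt
  chain-cons⁺ {γ = a ∷ _} (c ∷ cs) {hi} le (S , s , C) =
    subst (λ z → Strip z (N ∷ c)) (sym eq) (≤-refl , ≤-trans (chain-hd cs C) le , S) ,
    trans (cong sum eq) (trans (cong (N +_) s) (sym (+-assoc N (sum c) a))) ,
    chain-cons⁺ cs le C
    where eq = bottomShape-map (N ∷_) cs hi

  chain-cons⁻ : ∀ {γ : Vec ℕ k} (cs : Vec (Vec ℕ m) k) {hi} →
    Chain γ (map (N ∷_) cs) (N ∷ hi) → Chain γ cs hi
  chain-cons⁻ {γ = []}    []       _           = tt
  chain-cons⁻ {γ = a ∷ _} (c ∷ cs) {hi} (S , s , C) =
    proj₂ (proj₂ (subst (λ z → Strip z (N ∷ c)) eq S)) ,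
    +-cancelˡ-≡ N _ _ (trans (cong sum (sym eq)) (trans s (+-assoc N (sum c) a))) ,
    chain-cons⁻ cs C
    where eq = bottomShape-map (N ∷_) cs hi

  FullTo : ℕ → Vec ℕ m → Set
  FullTo zero    _       = ⊤
  FullTo (suc j) []      = ⊥
  FullTo (suc j) (x ∷ v) = x ≡ N × FullTo j v

  full-fullTo : ∀ m → FullTo m (full m)
  full-fullTo zero    = tt
  full-fullTo (suc m) = refl , full-fullTo m

  fullTo-suc : ∀ j (v : Vec ℕ m) → FullTo (suc j) v → FullTo j v
  fullTo-suc zero    v       _        = tt
  fullTo-suc (suc j) (x ∷ v) (eq , F) = eq , fullTo-suc j v F

  -- Each part of the inner shape is squeezed between two consecutive parts of the outer one, so a
  -- step down keeps all full rows except possibly the last.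
  strip-fullTo : ∀ j (ls vs : Vec ℕ m) → Strip ls vs → FullTo (suc j) ls → FullTo j vs
  strip-fullTo zero    ls            vs       _                  _              = tt
  strip-fullTo (suc j) (_ ∷ (_ ∷ ls)) (v ∷ vs) (v≤N , N≤v , S) (refl , refl , F) =
    ≤-antisym v≤N N≤v , strip-fullTo j (N ∷ ls) vs S (refl , F)

  chain-fullTo : ∀ {γ : Vec ℕ k} j (cs : Vec (Vec ℕ m) k) {hi} → Chain γ cs hi →
    FullTo (k + j) hi → FullTo j (bottomShape cs hi)
  chain-fullTo {γ = []}        j []       _           F = F
  chain-fullTo {suc k} {γ = _ ∷ _} j (c ∷ cs) {hi} (S , _ , C) F =
    strip-fullTo j _ c S
      (chain-fullTo (suc j) cs C (subst (λ z → FullTo z hi) (sym (+-suc k j)) F))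

  chain-heads : ∀ {γ : Vec ℕ k} (cs : Vec (Vec ℕ (suc m)) k) {hi} → Chain γ cs hi →
    FullTo (k + 1) hi → cs ≡ map (N ∷_) (map tail cs)
  chain-heads {γ = []}    []             _               F = refl
  chain-heads {γ = _ ∷ _} ((x ∷ c) ∷ cs) {hi} C@(_ , _ , C′) F =
    cong₂ _∷_ (cong (_∷ c) (proj₁ (chain-fullTo 1 ((x ∷ c) ∷ cs) C F)))
              (chain-heads cs C′ (fullTo-suc _ hi F))

  -- Passing from ρ to the next row of the pattern loses b cells and gains a full row, hence the
  -- size N - b. The bound on β is an inequality because the induction removes parts of β; it makes
  -- each N ∸ b a true difference.
  complete-ok : ∀ {β : Vec ℕ m} t → Pattern β t → hd (top t) ≤ N → sum β ≤ N →
    Chain (map (N ∸_) β) (complete t) (full m)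
  complete-ok {β = []} t _ _ _ = tt
  complete-ok {suc m} {β = b ∷ β} (ρ , t) (S , s , P) ρ≤N β≤N =
    subst (λ z → Strip z ρ) (sym eq) S′ ,
    trans (cong sum eq) size ,
    chain-cons⁺ (complete t) (hd-full m)
      (complete-ok t P (≤-trans (hd-step ρ (top t) S) ρ≤N) (m+n≤o⇒n≤o b β≤N))
    where
    S′ : Strip (N ∷ top t) ρ
    S′ = strip-shift⁺ ρ (top t) ρ≤N S
    hd-step : ∀ {m} ρ (v : Vec ℕ m) → Strip ρ (v ∷ʳ 0) → hd v ≤ hd ρ
    hd-step ρ       []      _        = z≤n
    hd-step (_ ∷ _) (_ ∷ _) (le , _) = le
    eq : bottomShape (map (N ∷_) (complete t)) (full (suc m)) ≡ N ∷ top t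
    eq = trans (bottomShape-map (N ∷_) (complete t) (full m)) (cong (N ∷_) (bottomShape-complete t))
    open ≡-Reasoning
    size : N + sum (top t) ≡ sum ρ + (N ∸ b)
    size = begin
      N + sum (top t)             ≡⟨ +-comm N _ ⟩
      sum (top t) + N             ≡⟨ cong (sum (top t) +_) (m+[n∸m]≡n (m+n≤o⇒m≤o b β≤N)) ⟨
      sum (top t) + (b + (N ∸ b)) ≡⟨ +-assoc (sum (top t)) b (N ∸ b) ⟨
      sum (top t) + b + (N ∸ b)   ≡⟨ cong (_+ (N ∸ b)) s ⟨
      sum ρ + (N ∸ b)             ∎

  uncomplete-complete : (t : Triangle m) → uncomplete (complete t) ≡ t
  uncomplete-complete {zero}  t       = refl
  uncomplete-complete {suc m} (ρ , t) = cong (ρ ,_)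
    (trans (cong uncomplete (trans (sym (map-∘ tail (N ∷_) (complete t))) (map-id (complete t))))
           (uncomplete-complete t))

  uncomplete-ok : ∀ {β : Vec ℕ m} cs → Chain (map (N ∸_) β) cs (full m) → sum β ≤ N →
    Pattern β (uncomplete cs) × complete (uncomplete cs) ≡ cs
  uncomplete-ok {β = []} [] _ _ = tt , refl
  uncomplete-ok {suc m} {β = b ∷ β} (ρ ∷ cs) (S , s , C) β≤N
    -- The m shapes of `cs` are at most m steps below m + 1 full rows, so each of them still has a
    -- full first row.
    with chain-heads cs C (subst (λ z → FullTo z (full (suc m))) (+-comm 1 m) (full-fullTo (suc m)))
  ... | heads with uncomplete-ok (map tail cs) (chain-cons⁻ (map tail cs) C′) (m+n≤o⇒n≤o b β≤N)
    where
    C′ : Chain (map (N ∸_) β) (map (N ∷_) (map tail cs)) (full (suc m))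
    C′ = subst (λ z → Chain _ z (full (suc m))) heads C
  ... | P , eq = (strip-shift⁻ ρ (top t) (subst (λ z → Strip z ρ) next S) , size , P) ,
                 cong (ρ ∷_) (trans (cong (map (N ∷_)) eq) (sym heads))
    where
    t = uncomplete (map tail cs)
    next : bottomShape cs (full (suc m)) ≡ N ∷ top t
    next = begin
      bottomShape cs (full (suc m))               ≡⟨ cong (λ z → bottomShape z (full (suc m))) heads ⟩
      bottomShape (map (N ∷_) (map tail cs)) (full (suc m))
                                                  ≡⟨ bottomShape-map (N ∷_) (map tail cs) (full m) ⟩
      N ∷ bottomShape (map tail cs) (full m)      ≡⟨ cong (λ z → N ∷ bottomShape z (full m)) eq ⟨
      N ∷ bottomShape (complete t) (full m)       ≡⟨ cong (N ∷_) (bottomShape-complete t) ⟩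
      N ∷ top t                                   ∎
      where open ≡-Reasoning
    size : sum ρ ≡ sum (top t) + b
    size = +-cancelʳ-≡ (N ∸ b) _ _ (begin
      sum ρ + (N ∸ b)                   ≡⟨ s ⟨
      sum (bottomShape cs (full (suc m))) ≡⟨ cong sum next ⟩
      N + sum (top t)                   ≡⟨ +-comm N _ ⟩
      sum (top t) + N                   ≡⟨ cong (sum (top t) +_) (m+[n∸m]≡n (m+n≤o⇒m≤o b β≤N)) ⟨
      sum (top t) + (b + (N ∸ b))       ≡⟨ +-assoc (sum (top t)) b (N ∸ b) ⟨
      sum (top t) + b + (N ∸ b)         ∎)
      where open ≡-Reasoning

  rectangle : (α : Vec ℕ n) (β : Vec ℕ m) → sum α ≡ N → sum β ≡ N →
    PartialBijection (ChainPattern α β) (ChainFrom0 (α ++ map (N ∸_) β) (full m))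
  rectangle {n} {m} α β |α| |β| = record
    { to      = λ (cs , t) → cs ++ complete t
    ; from    = λ cs → take n cs , uncomplete (drop n cs)
    ; to-ok   = λ {(cs , t)} → to-ok cs t
    ; from-ok = λ {cs} → from-ok cs
    ; from-to = λ {(cs , t)} _ → from-to cs t
    ; to-from = λ {cs} → to-from cs
    }
    where
    to-ok : ∀ cs t → ChainPattern α β (cs , t) →
            ChainFrom0 (α ++ map (N ∸_) β) (full m) (cs ++ complete t)
    to-ok cs t (Z@(b , C) , P) =
      trans (bottomShape-++ cs (complete t) (full m)) (trans (cong (bottomShape cs) eq) b) ,
      chain-++⁺ cs (complete t) (subst (Chain α cs) (sym eq) C)
        (complete-ok t P
          -- The shape where the two chains meet has size N, so none of its parts exceeds the width
          -- of the rectangle.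
          (≤-trans (hd≤sum (top t)) (≤-reflexive (trans (chainFrom0-sum cs Z) |α|)))
          (≤-reflexive |β|))
      where eq = bottomShape-complete t

    split : ∀ cs → ChainFrom0 (α ++ map (N ∸_) β) (full m) cs →
      let ds = drop n cs in
      ChainFrom0 α (bottomShape ds (full m)) (take n cs) × Chain (map (N ∸_) β) ds (full m)
    split cs (b , C) = (bottom , proj₁ CD) , proj₂ CD
      where
      CD = chain-++⁻ α (take n cs) (drop n cs)
             (subst (λ z → Chain _ z (full m)) (sym (take++drop≡id n cs)) C)
      bottom = trans (sym (bottomShape-++ (take n cs) (drop n cs) (full m)))
                 (trans (cong (λ z → bottomShape z (full m)) (take++drop≡id n cs)) b)

    from-ok : ∀ cs → ChainFrom0 (α ++ map (N ∸_) β) (full m) cs →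
              ChainPattern α β (take n cs , uncomplete (drop n cs))
    from-ok cs Z with split cs Z
    ... | C , D with uncomplete-ok (drop n cs) D (≤-reflexive |β|)
    ... | P , eq = subst (λ z → ChainFrom0 α z (take n cs)) shape C , P
      where
      shape : bottomShape (drop n cs) (full m) ≡ top (uncomplete (drop n cs))
      shape = trans (cong (λ z → bottomShape z (full m)) (sym eq)) (bottomShape-complete (uncomplete (drop n cs)))

    from-to : ∀ (cs : Vec (Vec ℕ m) n) t →
              (take n (cs ++ complete t) , uncomplete (drop n (cs ++ complete t))) ≡ (cs , t)
    from-to cs t = cong₂ _,_ (take-++ cs (complete t))
      (trans (cong uncomplete (drop-++ cs (complete t))) (uncomplete-complete t))
      where
      take-++ : ∀ {A : Set} {n k} (xs : Vec A n) (ys : Vec A k) → take n (xs ++ ys) ≡ xs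
      take-++ []       ys = refl
      take-++ (x ∷ xs) ys = cong (x ∷_) (take-++ xs ys)
      drop-++ : ∀ {A : Set} {n k} (xs : Vec A n) (ys : Vec A k) → drop n (xs ++ ys) ≡ ys
      drop-++ []       ys = refl
      drop-++ (x ∷ xs) ys = drop-++ xs ys

    to-from : ∀ cs → ChainFrom0 (α ++ map (N ∸_) β) (full m) cs →
              take n cs ++ complete (uncomplete (drop n cs)) ≡ cs
    to-from cs Z = trans
      (cong (take n cs ++_) (proj₂ (uncomplete-ok (drop n cs) (proj₂ (split cs Z)) (≤-reflexive |β|))))
      (take++drop≡id n cs)

-- Patterns as chains from the empty shape

lower : Triangle m → Vec (Vec ℕ m) m
lower {zero}  _       = []
lower {suc m} (ρ , t) = map (_∷ʳ 0) (lower t ∷ʳ top t)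

-- Dropping last entries is faithful only where they are 0; the vanishing lemmas derive this from
-- the chain starting at the empty shape.
raise : Vec ℕ m → Vec (Vec ℕ m) m → Triangle m
raise {zero}  _  _  = tt
raise {suc m} hi cs = hi , raise (init (last cs)) (map init (init cs))

∷ʳ-init-last : {A : Set} (xs : Vec A (suc n)) → xs ≡ init xs ∷ʳ last xs
∷ʳ-init-last (x ∷ [])     = refl
∷ʳ-init-last (x ∷ y ∷ xs) = cong (x ∷_) (∷ʳ-init-last (y ∷ xs))

sum-∷ʳ0 : (v : Vec ℕ m) → sum (v ∷ʳ 0) ≡ sum v
sum-∷ʳ0 []      = refl
sum-∷ʳ0 (x ∷ v) = cong (x +_) (sum-∷ʳ0 v)

hd-∷ʳ0 : (v : Vec ℕ m) → hd (v ∷ʳ 0) ≡ hd v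
hd-∷ʳ0 []      = refl
hd-∷ʳ0 (x ∷ v) = refl

strip-pad⁺ : (ls vs : Vec ℕ m) → Strip ls vs → Strip (ls ∷ʳ 0) (vs ∷ʳ 0)
strip-pad⁺ []       []       _              = z≤n , z≤n , tt
strip-pad⁺ (l ∷ ls) (v ∷ vs) (le , le′ , S) =
  le , ≤-trans (≤-reflexive (hd-∷ʳ0 ls)) le′ , strip-pad⁺ ls vs S

strip-pad⁻ : (ls vs : Vec ℕ m) → Strip (ls ∷ʳ 0) (vs ∷ʳ 0) → Strip ls vs
strip-pad⁻ []       []       _              = tt
strip-pad⁻ (l ∷ ls) (v ∷ vs) (le , le′ , S) =
  le , ≤-trans (≤-reflexive (sym (hd-∷ʳ0 ls))) le′ , strip-pad⁻ ls vs S

chain-pad⁺ : ∀ {α : Vec ℕ k} (cs : Vec (Vec ℕ m) k) {hi} →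
  Chain α cs hi → Chain α (map (_∷ʳ 0) cs) (hi ∷ʳ 0)
chain-pad⁺ {α = []}    []       _                = tt
chain-pad⁺ {α = a ∷ _} (c ∷ cs) {hi} (S , s , C) =
  subst (λ z → Strip z (c ∷ʳ 0)) (sym eq) (strip-pad⁺ _ c S) ,
  trans (cong sum eq) (trans (sum-∷ʳ0 (bottomShape cs hi)) (trans s (cong (_+ a) (sym (sum-∷ʳ0 c))))) ,
  chain-pad⁺ cs C
  where eq = bottomShape-map (_∷ʳ 0) cs hi

chain-pad⁻ : ∀ {α : Vec ℕ k} (cs : Vec (Vec ℕ m) k) {hi} →
  Chain α (map (_∷ʳ 0) cs) (hi ∷ʳ 0) → Chain α cs hi
chain-pad⁻ {α = []}    []       _                = tt
chain-pad⁻ {α = a ∷ _} (c ∷ cs) {hi} (S , s , C) =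
  strip-pad⁻ _ c (subst (λ z → Strip z (c ∷ʳ 0)) eq S) ,
  trans (sym (trans (cong sum eq) (sum-∷ʳ0 (bottomShape cs hi)))) (trans s (cong (_+ a) (sum-∷ʳ0 c))) ,
  chain-pad⁻ cs C
  where eq = bottomShape-map (_∷ʳ 0) cs hi

bottomShape-∷ʳ : (cs : Vec (Vec ℕ m) k) (c hi : Vec ℕ m) →
  bottomShape (cs ∷ʳ c) hi ≡ bottomShape cs c
bottomShape-∷ʳ []      c hi = refl
bottomShape-∷ʳ (_ ∷ _) c hi = refl

chain-∷ʳ⁺ : ∀ {α : Vec ℕ k} {a} (cs : Vec (Vec ℕ m) k) {c hi} →
  Chain α cs c → Strip hi c → sum hi ≡ sum c + a → Chain (α ∷ʳ a) (cs ∷ʳ c) hi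
chain-∷ʳ⁺ {α = []}    []        _           T t = T , t , tt
chain-∷ʳ⁺ {α = _ ∷ _} (c′ ∷ cs) {c} {hi} (S , s , C) T t =
  subst (λ z → Strip z c′) (sym (bottomShape-∷ʳ cs c hi)) S ,
  trans (cong sum (bottomShape-∷ʳ cs c hi)) s , chain-∷ʳ⁺ cs C T t

chain-∷ʳ⁻ : ∀ (α : Vec ℕ k) {a} (cs : Vec (Vec ℕ m) k) {c hi} →
  Chain (α ∷ʳ a) (cs ∷ʳ c) hi → Chain α cs c × Strip hi c × sum hi ≡ sum c + a
chain-∷ʳ⁻ []      []        (T , t , _) = tt , T , t
chain-∷ʳ⁻ (_ ∷ α) (c′ ∷ cs) {c} {hi} (S , s , C) with chain-∷ʳ⁻ α cs C
... | C′ , Tt =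
  (subst (λ z → Strip z c′) (bottomShape-∷ʳ cs c hi) S ,
   trans (cong sum (sym (bottomShape-∷ʳ cs c hi))) s , C′) , Tt

VanishesFrom : ℕ → Vec ℕ m → Set
VanishesFrom _       []      = ⊤
VanishesFrom zero    (x ∷ v) = x ≡ 0 × VanishesFrom zero v
VanishesFrom (suc j) (x ∷ v) = VanishesFrom j v

zeros-vanish : ∀ m → VanishesFrom 0 (zeros {m})
zeros-vanish zero    = tt
zeros-vanish (suc m) = refl , zeros-vanish m

-- Each part of the outer shape is at most the preceding part of the inner one, so a strip opens at
-- most one new row.
strip-vanish⁺ : ∀ j (ls vs : Vec ℕ m) → Strip ls vs → VanishesFrom j vs → VanishesFrom (suc j) ls
strip-vanish⁺ j       []            []       _             _       = tt
strip-vanish⁺ zero    (l ∷ [])      (v ∷ vs) _             _       = tt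
strip-vanish⁺ zero    (l ∷ l′ ∷ ls) (v ∷ vs) (_ , l′≤v , S) (v≡0 , V) =
  n≤0⇒n≡0 (≤-trans l′≤v (≤-reflexive v≡0)) , strip-vanish⁺ zero (l′ ∷ ls) vs S V
strip-vanish⁺ (suc j) (l ∷ ls)      (v ∷ vs) (_ , _ , S)   V       = strip-vanish⁺ j ls vs S V

strip-vanish⁻ : ∀ j (ls vs : Vec ℕ m) → Strip ls vs → VanishesFrom j ls → VanishesFrom j vs
strip-vanish⁻ j       []       []       _            _         = tt
strip-vanish⁻ zero    (l ∷ ls) (v ∷ vs) (v≤l , _ , S) (l≡0 , V) =
  n≤0⇒n≡0 (≤-trans v≤l (≤-reflexive l≡0)) , strip-vanish⁻ zero ls vs S V
strip-vanish⁻ (suc j) (l ∷ ls) (v ∷ vs) (_ , _ , S)  V         = strip-vanish⁻ j ls vs S V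

chain-vanish⁺ : ∀ {α : Vec ℕ k} j (cs : Vec (Vec ℕ m) k) {hi} → Chain α cs hi →
  VanishesFrom j (bottomShape cs hi) → VanishesFrom (k + j) hi
chain-vanish⁺ {α = []}    j []       _           V = V
chain-vanish⁺ {suc k} {α = _ ∷ _} j (c ∷ cs) {hi} (S , _ , C) V =
  subst (λ z → VanishesFrom z hi) (+-suc k j) (chain-vanish⁺ (suc j) cs C (strip-vanish⁺ j _ c S V))

chain-vanish⁻ : ∀ {α : Vec ℕ k} j (cs : Vec (Vec ℕ m) k) {hi} → Chain α cs hi →
  VanishesFrom j hi → VanishesFrom j (bottomShape cs hi)
chain-vanish⁻ {α = []}    j []       _           V = V
chain-vanish⁻ {α = _ ∷ _} j (c ∷ cs) (S , _ , C) V = strip-vanish⁻ j _ c S (chain-vanish⁻ j cs C V)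

vanish⇒padded : (v : Vec ℕ (suc m)) → VanishesFrom m v → v ≡ init v ∷ʳ 0
vanish⇒padded (x ∷ [])    (eq , _) = cong (_∷ []) eq
vanish⇒padded (x ∷ y ∷ v) V        = cong (x ∷_) (vanish⇒padded (y ∷ v) V)

chain-padded : ∀ {α : Vec ℕ k} (cs : Vec (Vec ℕ (suc m)) k) {hi} → Chain α cs hi →
  VanishesFrom m hi → cs ≡ map (_∷ʳ 0) (map init cs)
chain-padded {α = []}    []       _             V = refl
chain-padded {m = m} {α = _ ∷ _} (c ∷ cs) C@(_ , _ , C′) V =
  cong₂ _∷_ (vanish⇒padded c (chain-vanish⁻ m (c ∷ cs) C V)) (chain-padded cs C′ V)

lower-ok : ∀ {β : Vec ℕ m} t → Pattern β t → ChainFrom0 (reverse β) (top t) (lower t)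
lower-ok {β = []} t _ = refl , tt
lower-ok {suc m} {β = b ∷ β} (ρ , t) (S , s , P) with lower-ok t P
... | bot , C
  rewrite reverse-∷ b β | map-∷ʳ (_∷ʳ 0) (top t) (lower t) =
  trans (bottomShape-∷ʳ (map (_∷ʳ 0) (lower t)) (top t ∷ʳ 0) ρ)
    (trans (bottomShape-map (_∷ʳ 0) (lower t) (top t)) (trans (cong (_∷ʳ 0) bot) (zeros-∷ʳ m))) ,
  chain-∷ʳ⁺ (map (_∷ʳ 0) (lower t)) (chain-pad⁺ (lower t) C) S
    (trans s (cong (_+ b) (sym (sum-∷ʳ0 (top t)))))

map-init-∷ʳ : (cs : Vec (Vec ℕ m) k) → map init (map (_∷ʳ 0) cs) ≡ cs
map-init-∷ʳ []       = refl
map-init-∷ʳ (c ∷ cs) = cong₂ _∷_ (init-∷ʳ 0 c) (map-init-∷ʳ cs)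

raise-lower : (t : Triangle m) → raise (top t) (lower t) ≡ t
raise-lower {zero}  t       = refl
raise-lower {suc m} (ρ , t)
  rewrite map-∷ʳ (_∷ʳ 0) (top t) (lower t)
        | last-∷ʳ (top t ∷ʳ 0) (map (_∷ʳ 0) (lower t))
        | init-∷ʳ (top t ∷ʳ 0) (map (_∷ʳ 0) (lower t))
        | init-∷ʳ 0 (top t)
        | map-init-∷ʳ (lower t) = cong (ρ ,_) (raise-lower t)

top-raise : (hi : Vec ℕ m) (cs : Vec (Vec ℕ m) m) → top (raise hi cs) ≡ hi
top-raise []      cs = refl
top-raise (_ ∷ _) cs = refl

raise-ok : ∀ {β : Vec ℕ m} hi cs → ChainFrom0 (reverse β) hi cs →
  Pattern β (raise hi cs) × lower (raise hi cs) ≡ cs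
raise-ok {β = []} [] [] _ = tt , refl
raise-ok {suc m} {β = b ∷ β} hi cs (bot , C)
  with chain-∷ʳ⁻ (reverse β) (init cs) (subst₂ (λ x y → Chain x y hi) (reverse-∷ b β) (∷ʳ-init-last cs) C)
... | C₀ , S , s =
  (subst (Strip hi) (trans padded (cong (_∷ʳ 0) (sym (top-raise c′ cs′)))) S ,
   trans s (cong (_+ b) (trans (cong sum padded) (trans (sum-∷ʳ0 c′) (cong sum (sym (top-raise c′ cs′)))))) ,
   proj₁ IH) ,
  eq
  where
  c   = last cs
  c′  = init c
  cs′ = map init (init cs)
  bot₀ : bottomShape (init cs) c ≡ zeros
  bot₀ = trans (sym (bottomShape-∷ʳ (init cs) c hi))
           (trans (cong (λ z → bottomShape z hi) (sym (∷ʳ-init-last cs))) bot)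
  -- `c` lies m steps above the empty shape and has m + 1 parts, so its last part is 0.
  V : VanishesFrom m c
  V = subst (λ z → VanishesFrom z c) (+-identityʳ m)
        (chain-vanish⁺ 0 (init cs) C₀ (subst (VanishesFrom 0) (sym bot₀) (zeros-vanish (suc m))))
  padded : c ≡ c′ ∷ʳ 0
  padded = vanish⇒padded c V
  padded′ : init cs ≡ map (_∷ʳ 0) cs′
  padded′ = chain-padded (init cs) C₀ V
  init-zeros : ∀ m → init (zeros {suc m}) ≡ zeros
  init-zeros zero    = refl
  init-zeros (suc m) = cong (0 ∷_) (init-zeros m)
  bot′ : bottomShape cs′ c′ ≡ zeros
  bot′ = trans (bottomShape-map init (init cs) c) (trans (cong init bot₀) (init-zeros m))
  IH = raise-ok c′ cs′ (bot′ , chain-pad⁻ cs′ (subst₂ (Chain (reverse β)) padded′ padded C₀))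
  open ≡-Reasoning
  eq : map (_∷ʳ 0) (lower (raise c′ cs′) ∷ʳ top (raise c′ cs′)) ≡ cs
  eq = begin
    map (_∷ʳ 0) (lower (raise c′ cs′) ∷ʳ top (raise c′ cs′))
      ≡⟨ cong₂ (λ x y → map (_∷ʳ 0) (x ∷ʳ y)) (proj₂ IH) (top-raise c′ cs′) ⟩
    map (_∷ʳ 0) (cs′ ∷ʳ c′)         ≡⟨ map-∷ʳ (_∷ʳ 0) c′ cs′ ⟩
    map (_∷ʳ 0) cs′ ∷ʳ (c′ ∷ʳ 0)    ≡⟨ cong₂ _∷ʳ_ padded′ padded ⟨
    init cs ∷ʳ c                    ≡⟨ ∷ʳ-init-last cs ⟨
    cs                              ∎

ChainPair : Vec ℕ n → Vec ℕ k → Vec ℕ m × Vec (Vec ℕ m) n × Vec (Vec ℕ m) k → Set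
ChainPair α β (hi , cs , ds) = ChainFrom0 α hi cs × ChainFrom0 β hi ds

patternToChain : (α : Vec ℕ n) (β : Vec ℕ m) →
  PartialBijection (ChainPattern α β) (ChainPair α (reverse β))
patternToChain α β = record
  { to      = λ (cs , t) → top t , cs , lower t
  ; from    = λ (hi , cs , ds) → cs , raise hi ds
  ; to-ok   = λ {(cs , t)} (C , P) → C , lower-ok t P
  ; from-ok = λ {(hi , cs , ds)} (C , D) →
      subst (λ z → ChainFrom0 α z cs) (sym (top-raise hi ds)) C , proj₁ (raise-ok hi ds D)
  ; from-to = λ {(cs , t)} _ → cong (cs ,_) (raise-lower t)
  ; to-from = λ {(hi , cs , ds)} (_ , D) →
      cong₂ (λ x y → x , cs , y) (top-raise hi ds) (proj₂ (raise-ok {β = β} hi ds D))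
  }

-- Sorted words and their weights

weight : List (Fin k) → Vec ℕ k
weight []       = zeros
weight (x ∷ xs) = updateAt (weight xs) x suc

expand : Vec ℕ k → List (Fin k)
expand []      = []
expand (a ∷ v) = List.replicate a zero List.++ List.map suc (expand v)

Sorted : List (Fin k) → Set
Sorted = AllPairs Fin._≤_

sum-updateAt-suc : (v : Vec ℕ k) (x : Fin k) → sum (updateAt v x suc) ≡ suc (sum v)
sum-updateAt-suc (a ∷ v) zero    = refl
sum-updateAt-suc (a ∷ v) (suc x) = trans (cong (a +_) (sum-updateAt-suc v x)) (+-suc a (sum v))

sum-weight : (xs : List (Fin k)) → sum (weight xs) ≡ length xs
sum-weight {k} []  = sum-zeros k
sum-weight (x ∷ xs) = trans (sum-updateAt-suc (weight xs) x) (cong suc (sum-weight xs))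

weight-++ : (xs ys : List (Fin k)) → weight (xs List.++ ys) ≡ weight xs ⊕ weight ys
weight-++ []       ys = sym (⊕-identityˡ (weight ys))
weight-++ (x ∷ xs) ys =
  trans (cong (λ v → updateAt v x suc) (weight-++ xs ys)) (updateAt-⊕ x (weight xs) (weight ys))
  where
  updateAt-⊕ : ∀ {k} (x : Fin k) u v → updateAt (u ⊕ v) x suc ≡ updateAt u x suc ⊕ v
  updateAt-⊕ zero    (_ ∷ _) (_ ∷ _) = refl
  updateAt-⊕ (suc x) (a ∷ u) (b ∷ v) = cong (a + b ∷_) (updateAt-⊕ x u v)

weight-map-suc : (xs : List (Fin k)) → weight (List.map suc xs) ≡ 0 ∷ weight xs
weight-map-suc []       = refl
weight-map-suc (x ∷ xs) = cong (λ v → updateAt v (suc x) suc) (weight-map-suc xs)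

weight-expand : (v : Vec ℕ k) → weight (expand v) ≡ v
weight-expand []          = refl
weight-expand (zero ∷ v)  = trans (weight-map-suc (expand v)) (cong (0 ∷_) (weight-expand v))
weight-expand (suc a ∷ v) = cong (λ v → updateAt v zero suc) (weight-expand (a ∷ v))

length-expand : (v : Vec ℕ k) → length (expand v) ≡ sum v
length-expand v = trans (sym (sum-weight (expand v))) (cong sum (weight-expand v))

expand-sorted : (v : Vec ℕ k) → Sorted (expand v)
expand-sorted []          = []
expand-sorted (zero ∷ v)  = AllPairs.map⁺ (AllPairs.map s≤s (expand-sorted v))
expand-sorted (suc a ∷ v) = All.universal (λ _ → z≤n) _ ∷ expand-sorted (a ∷ v)

-- The first letter x of a sorted word is its least, so the counts below x vanish and one more x is
-- expanded to the front.
expand-weight : (xs : List (Fin k)) → Sorted xs → expand (weight xs) ≡ xs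
expand-weight {k} [] _ = expand-zeros k
  where
  expand-zeros : ∀ k → expand (zeros {k}) ≡ []
  expand-zeros zero    = refl
  expand-zeros (suc k) = cong (List.map suc) (expand-zeros k)
expand-weight (x ∷ xs) (x≤xs ∷ S) =
  trans (expand-updateAt x (weight xs) (weight-below x xs x≤xs)) (cong (x ∷_) (expand-weight xs S))
  where
  weight-below : ∀ {k} (x : Fin k) (xs : List (Fin k)) → All (x Fin.≤_) xs →
    (i : Fin k) → i Fin.< x → lookup (weight xs) i ≡ 0
  weight-below x []       []         i i<x = lookup-zeros i
    where
    lookup-zeros : ∀ {k} (i : Fin k) → lookup (zeros {k}) i ≡ 0
    lookup-zeros zero    = refl
    lookup-zeros (suc i) = lookup-zeros i
  weight-below x (y ∷ xs) (x≤y ∷ le) i i<x =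
    trans (unaffected i y (weight xs) (<-≤-trans i<x x≤y)) (weight-below x xs le i i<x)
    where
    unaffected : ∀ {k} (i y : Fin k) (v : Vec ℕ k) → i Fin.< y → lookup (updateAt v y suc) i ≡ lookup v i
    unaffected zero    (suc y) (_ ∷ _) _         = refl
    unaffected (suc i) (suc y) (_ ∷ v) (s≤s i<y) = unaffected i y v i<y
  expand-updateAt : ∀ {k} (x : Fin k) v → (∀ i → i Fin.< x → lookup v i ≡ 0) →
    expand (updateAt v x suc) ≡ x ∷ expand v
  expand-updateAt zero    (a ∷ v) _  = refl
  expand-updateAt (suc x) (a ∷ v) Z with refl ← Z zero z<s =
    cong (List.map suc) (expand-updateAt x v (λ i i<x → Z (suc i) (s≤s i<x)))

-- Adjacent rows of a tableau

Above : List (Fin k) → List (Fin k) → Set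
Above _       []      = ⊤
Above []      (_ ∷ _) = ⊥
Above (x ∷ u) (y ∷ v) = x Fin.< y × Above u v

-- u and v count the letters of an upper and a lower row whose first l and l′
-- cells are removed: the letters ≤ i of the lower row lie below removed cells or letters < i.
Dominates : ℕ → ℕ → Vec ℕ k → Vec ℕ k → Set
Dominates l l′ []      []      = ⊤
Dominates l l′ (x ∷ u) (y ∷ v) = l′ + y ≤ l × Dominates (l + x) (l′ + y) u v

above-map-suc⁺ : (u v : List (Fin k)) → Above u v → Above (List.map suc u) (List.map suc v)
above-map-suc⁺ u       []      _        = tt
above-map-suc⁺ (x ∷ u) (y ∷ v) (lt , A) = s≤s lt , above-map-suc⁺ u v A

above-map-suc⁻ : (u v : List (Fin k)) → Above (List.map suc u) (List.map suc v) → Above u v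
above-map-suc⁻ u       []      _            = tt
above-map-suc⁻ (x ∷ u) (y ∷ v) (s≤s lt , A) = lt , above-map-suc⁻ u v A

above-zeros⁺ : ∀ x (u v : List (Fin k)) → Above u (List.drop x v) →
  Above (List.replicate x zero List.++ List.map suc u) (List.map suc v)
above-zeros⁺ zero    u v       A = above-map-suc⁺ u v A
above-zeros⁺ (suc x) u []      A = tt
above-zeros⁺ (suc x) u (y ∷ v) A = z<s , above-zeros⁺ x u v A

above-zeros⁻ : ∀ x (u v : List (Fin k)) →
  Above (List.replicate x zero List.++ List.map suc u) (List.map suc v) → Above u (List.drop x v)
above-zeros⁻ zero    u v       A       = above-map-suc⁻ u v A
above-zeros⁻ (suc x) u []      A       = tt
above-zeros⁻ (suc x) u (y ∷ v) (_ , A) = above-zeros⁻ x u v A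

drop-zeros : ∀ y e (v : List (Fin k)) →
  List.drop (y + e) (List.replicate y Fin.zero List.++ List.map Fin.suc v) ≡
  List.map Fin.suc (List.drop e v)
drop-zeros zero    e v = drop-map e v
drop-zeros (suc y) e v = drop-zeros y e v

-- A least letter of the lower row survives the removal, and no letter can stand above it.
drop-too-few : ∀ d y (v : List (Fin (suc k))) u → d < y →
  ¬ Above u (List.drop d (List.replicate y zero List.++ v))
drop-too-few zero    (suc y) v (x ∷ u) _         (() , _)
drop-too-few (suc d) (suc y) v u       (s≤s d<y) A = drop-too-few d y v u d<y A

private
  offset : ∀ l′ y e x → l′ + (y + e) + x ≡ l′ + y + (e + x)
  offset = solve-∀

-- Here `d` is the lead of the upper row: the next d letters of the lower row stand below cells
-- already passed. Passing the least letter, with x copies above and y ≤ d below, changes the lead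
-- to d - y + x.
dominates⇒above′ : ∀ l′ d (u v : Vec ℕ k) → Dominates (l′ + d) l′ u v →
  Above (expand u) (List.drop d (expand v))
dominates⇒above′ l′ zero    []      []      _ = tt
dominates⇒above′ l′ (suc d) []      []      _ = tt
dominates⇒above′ l′ d (x ∷ u) (y ∷ v) (le , D)
  with e , refl ← m≤n⇒∃[o]m+o≡n (+-cancelˡ-≤ l′ y d le) =
  subst (Above (expand (x ∷ u))) (sym (drop-zeros y e (expand v)))
    (above-zeros⁺ x (expand u) (List.drop e (expand v))
      (subst (Above (expand u)) (sym (drop-drop e x (expand v)))
        (dominates⇒above′ (l′ + y) (e + x) u v
          (subst (λ z → Dominates z (l′ + y) u v) (offset l′ y e x) D))))

above⇒dominates′ : ∀ l′ d (u v : Vec ℕ k) → Above (expand u) (List.drop d (expand v)) →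
  Dominates (l′ + d) l′ u v
above⇒dominates′ l′ d []      []      _ = tt
above⇒dominates′ l′ d (x ∷ u) (y ∷ v) A with y ≤? d
... | no y≰d = ⊥-elim (drop-too-few d y _ _ (≰⇒> y≰d) A)
... | yes y≤d
  with e , refl ← m≤n⇒∃[o]m+o≡n y≤d =
  +-monoʳ-≤ l′ (m≤m+n y e) ,
  subst (λ z → Dominates z (l′ + y) u v) (sym (offset l′ y e x))
    (above⇒dominates′ (l′ + y) (e + x) u v
      (subst (Above (expand u)) (drop-drop e x (expand v))
        (above-zeros⁻ x (expand u) (List.drop e (expand v))
          (subst (Above (expand (x ∷ u))) (drop-zeros y e (expand v)) A))))

dominates⇒above : (u v : Vec ℕ k) → Dominates 0 0 u v → Above (expand u) (expand v)
dominates⇒above = dominates⇒above′ 0 0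

above⇒dominates : (u v : List (Fin k)) → Sorted u → Sorted v → Above u v →
  Dominates 0 0 (weight u) (weight v)
above⇒dominates u v Su Sv A = above⇒dominates′ 0 0 (weight u) (weight v)
  (subst₂ Above (sym (expand-weight u Su)) (sym (expand-weight v Sv)) A)

-- Letter counts of the rows of a tableau, and chains of shapes

DominatesAll : Vec ℕ m → Vec (Vec ℕ k) m → Set
DominatesAll []            []          = ⊤
DominatesAll (l ∷ [])      (u ∷ [])    = ⊤
DominatesAll (l ∷ l′ ∷ lo) (u ∷ v ∷ M) = Dominates l l′ u v × DominatesAll (l′ ∷ lo) (v ∷ M)

-- The letter counts of the rows of a semistandard filling of type μ of the skew shape hi/lo.
Filling : Vec ℕ m → Vec ℕ m → Vec ℕ k → Vec (Vec ℕ k) m → Set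
Filling lo hi μ M = lo ⊕ map sum M ≡ hi × columnSums M ≡ μ × DominatesAll lo M

chainOf : Vec ℕ m → Vec (Vec ℕ k) m → Vec (Vec ℕ m) k
chainOf {k = zero}  lo M = []
chainOf {k = suc k} lo M = lo ∷ chainOf (lo ⊕ map head M) (map tail M)

stepsOf : Vec (Vec ℕ m) k → Vec ℕ m → Vec (Vec ℕ k) m
stepsOf []       hi = replicate _ []
stepsOf (c ∷ cs) hi = zipWith _∷_ (zipWith _∸_ (bottomShape cs hi) c) (stepsOf cs hi)

⊕-map-sum : (lo : Vec ℕ m) (M : Vec (Vec ℕ (suc k)) m) →
  lo ⊕ map sum M ≡ lo ⊕ map head M ⊕ map sum (map tail M)
⊕-map-sum []       []            = refl
⊕-map-sum (l ∷ lo) ((x ∷ u) ∷ M) = cong₂ _∷_ (sym (+-assoc l x (sum u))) (⊕-map-sum lo M)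

⊕-map-sum-[] : (lo : Vec ℕ m) (M : Vec (Vec ℕ 0) m) → lo ⊕ map sum M ≡ lo
⊕-map-sum-[] []       []       = refl
⊕-map-sum-[] (l ∷ lo) ([] ∷ M) = cong₂ _∷_ (+-identityʳ l) (⊕-map-sum-[] lo M)

columnSums-split : (M : Vec (Vec ℕ (suc k)) m) →
  columnSums M ≡ sum (map head M) ∷ columnSums (map tail M)
columnSums-split []            = refl
columnSums-split ((x ∷ u) ∷ M) rewrite columnSums-split M = refl

-- For the least letter, the clause l′ + y ≤ l of `Dominates` is the condition that its cells form a
-- horizontal strip over `lo`. So this letter can be split off all rows at once, with the enlarged
-- shape as the new start.
dominatesAll⁻ : (lo : Vec ℕ m) (M : Vec (Vec ℕ (suc k)) m) → DominatesAll lo M →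
  Strip (lo ⊕ map head M) lo × DominatesAll (lo ⊕ map head M) (map tail M)
dominatesAll⁻ []            []                      _ = tt , tt
dominatesAll⁻ (l ∷ [])      ((x ∷ u) ∷ [])          _ = (m≤m+n l x , z≤n , tt) , tt
dominatesAll⁻ (l ∷ l′ ∷ lo) ((x ∷ u) ∷ (y ∷ v) ∷ M) ((le , D) , Ds)
  with dominatesAll⁻ (l′ ∷ lo) ((y ∷ v) ∷ M) Ds
... | S , Ds′ = (m≤m+n l x , le , S) , (D , Ds′)

dominatesAll⁺ : (lo : Vec ℕ m) (M : Vec (Vec ℕ (suc k)) m) →
  Strip (lo ⊕ map head M) lo → DominatesAll (lo ⊕ map head M) (map tail M) → DominatesAll lo M
dominatesAll⁺ []            []                      _            _        = tt
dominatesAll⁺ (l ∷ [])      ((x ∷ u) ∷ [])          _            _        = tt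
dominatesAll⁺ (l ∷ l′ ∷ lo) ((x ∷ u) ∷ (y ∷ v) ∷ M) (_ , le , S) (D , Ds) =
  (le , D) , dominatesAll⁺ (l′ ∷ lo) ((y ∷ v) ∷ M) S Ds

dominatesAll-[] : (lo : Vec ℕ m) (M : Vec (Vec ℕ 0) m) → DominatesAll lo M
dominatesAll-[] []            []            = tt
dominatesAll-[] (l ∷ [])      (u ∷ [])      = tt
dominatesAll-[] (l ∷ l′ ∷ lo) ([] ∷ [] ∷ M) = tt , dominatesAll-[] (l′ ∷ lo) ([] ∷ M)

map-head-zipWith : (xs : Vec ℕ m) (M : Vec (Vec ℕ k) m) → map head (zipWith _∷_ xs M) ≡ xs
map-head-zipWith []       []      = refl
map-head-zipWith (x ∷ xs) (u ∷ M) = cong (x ∷_) (map-head-zipWith xs M)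

map-tail-zipWith : (xs : Vec ℕ m) (M : Vec (Vec ℕ k) m) → map tail (zipWith _∷_ xs M) ≡ M
map-tail-zipWith []       []      = refl
map-tail-zipWith (x ∷ xs) (u ∷ M) = cong (u ∷_) (map-tail-zipWith xs M)

zipWith-head-tail : (M : Vec (Vec ℕ (suc k)) m) → zipWith _∷_ (map head M) (map tail M) ≡ M
zipWith-head-tail []            = refl
zipWith-head-tail ((x ∷ u) ∷ M) = cong ((x ∷ u) ∷_) (zipWith-head-tail M)

strip-⊕-∸ : (ls vs : Vec ℕ m) → Strip ls vs → vs ⊕ zipWith _∸_ ls vs ≡ ls
strip-⊕-∸ []       []       _            = refl
strip-⊕-∸ (l ∷ ls) (v ∷ vs) (le , _ , S) = cong₂ _∷_ (m+[n∸m]≡n le) (strip-⊕-∸ ls vs S)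

⊕-∸ : (u v : Vec ℕ m) → zipWith _∸_ (u ⊕ v) u ≡ v
⊕-∸ []      []      = refl
⊕-∸ (x ∷ u) (y ∷ v) = cong₂ _∷_ (m+n∸m≡n x y) (⊕-∸ u v)

chainOf-bottom : (lo hi : Vec ℕ m) (M : Vec (Vec ℕ k) m) → lo ⊕ map sum M ≡ hi →
  bottomShape (chainOf lo M) hi ≡ lo
chainOf-bottom {k = zero}  lo hi M eq = trans (sym eq) (⊕-map-sum-[] lo M)
chainOf-bottom {k = suc k} lo hi M eq = refl

chainOf-ok : ∀ (lo hi : Vec ℕ m) {μ : Vec ℕ k} M → Filling lo hi μ M → Chain μ (chainOf lo M) hi
chainOf-ok lo hi {[]}    M _ = tt
chainOf-ok lo hi {a ∷ μ} M (rows , columns , Ds)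
  with trans (sym (columnSums-split M)) columns | dominatesAll⁻ lo M Ds
... | refl | S , Ds′ =
  subst (λ z → Strip z lo) (sym bot) S ,
  trans (cong sum bot) (sum-⊕ lo (map head M)) ,
  chainOf-ok (lo ⊕ map head M) hi (map tail M) (rows′ , refl , Ds′)
  where
  rows′ = trans (sym (⊕-map-sum lo M)) rows
  bot   = chainOf-bottom (lo ⊕ map head M) hi (map tail M) rows′

stepsOf-chainOf : ∀ (lo hi : Vec ℕ m) (M : Vec (Vec ℕ k) m) → lo ⊕ map sum M ≡ hi →
  stepsOf (chainOf lo M) hi ≡ M
stepsOf-chainOf {k = zero}  lo hi M rows = all-[] M
  where
  all-[] : ∀ {m} (M : Vec (Vec ℕ 0) m) → replicate m [] ≡ M
  all-[] []       = refl
  all-[] ([] ∷ M) = cong ([] ∷_) (all-[] M)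
stepsOf-chainOf {k = suc k} lo hi M rows
  rewrite chainOf-bottom (lo ⊕ map head M) hi (map tail M) (trans (sym (⊕-map-sum lo M)) rows)
        | stepsOf-chainOf (lo ⊕ map head M) hi (map tail M) (trans (sym (⊕-map-sum lo M)) rows)
        | ⊕-∸ lo (map head M) = zipWith-head-tail M

columnSums-[] : (M : Vec (Vec ℕ 0) m) → columnSums M ≡ []
columnSums-[] M with columnSums M
... | [] = refl

stepsOf-ok : ∀ (hi : Vec ℕ m) {μ : Vec ℕ k} cs → Chain μ cs hi →
  Filling (bottomShape cs hi) hi μ (stepsOf cs hi) ×
  chainOf (bottomShape cs hi) (stepsOf cs hi) ≡ cs
stepsOf-ok {m = m} hi {[]} [] _ =
  (⊕-map-sum-[] hi M , columnSums-[] M , dominatesAll-[] hi M) , refl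
  where
  M : Vec (Vec ℕ 0) m
  M = replicate m []
stepsOf-ok {m = m} {k = suc k} hi {a ∷ μ} (c ∷ cs) (S , s , C)
  with stepsOf-ok hi cs C
... | (rows , columns , Ds) , eq =
  ( trans (⊕-map-sum c M) (trans (cong₂ (λ x y → x ⊕ map sum y) mid tails) rows)
  , trans (columnSums-split M)
      (cong₂ _∷_ (+-cancelˡ-≡ (sum c) _ _ (trans (sym (sum-⊕ c (map head M))) (trans (cong sum mid) s)))
                 (trans (cong columnSums tails) columns))
  , dominatesAll⁺ c M (subst (λ z → Strip z c) (sym mid) S)
      (subst₂ DominatesAll (sym mid) (sym tails) Ds)) ,
  cong (c ∷_) (trans (cong₂ chainOf mid tails) eq)
  where
  b  = bottomShape cs hi
  M  : Vec (Vec ℕ (suc k)) m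
  M  = stepsOf (c ∷ cs) hi
  tails : map tail M ≡ stepsOf cs hi
  tails = map-tail-zipWith (zipWith _∸_ b c) (stepsOf cs hi)
  mid : c ⊕ map head M ≡ b
  mid = trans (cong (c ⊕_) (map-head-zipWith (zipWith _∸_ b c) (stepsOf cs hi))) (strip-⊕-∸ b c S)

fillingToChain : (hi : Vec ℕ m) (μ : Vec ℕ k) →
  PartialBijection (Filling zeros hi μ) (ChainFrom0 μ hi)
fillingToChain hi μ = record
  { to      = chainOf zeros
  ; from    = λ cs → stepsOf cs hi
  ; to-ok   = λ {M} F → chainOf-bottom zeros hi M (proj₁ F) , chainOf-ok zeros hi M F
  ; from-ok = λ {cs} (b , C) →
      subst (λ z → Filling z hi μ (stepsOf cs hi)) b (proj₁ (stepsOf-ok hi cs C))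
  ; from-to = λ {M} F → stepsOf-chainOf zeros hi M (proj₁ F)
  ; to-from = λ {cs} (b , C) →
      trans (cong (λ z → chainOf z (stepsOf cs hi)) (sym b)) (proj₂ (stepsOf-ok hi cs C))
  }

-- With `key` the data that a setoid compares, a preimage certifies that the data are valid, while
-- round trips speak of the data alone.
Image : {X A : Set} → (X → A) → A → Set
Image key a = ∃ λ x → key x ≡ a

-- Semistandard tableaux by rows

lookup-ext : {u v : Vec ℕ k} → (∀ i → lookup u i ≡ lookup v i) → u ≡ v
lookup-ext {u = u} {v} eq =
  trans (sym (tabulate∘lookup u)) (trans (tabulate-cong eq) (tabulate∘lookup v))

lookup-weight : (xs : List (Fin k)) (i : Fin k) →
  lookup (weight xs) i ≡ length (List.filter (i Fin.≟_) xs)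
lookup-weight []       i = lookup-replicate i 0
lookup-weight (x ∷ xs) i with i Fin.≟ x
... | yes refl = trans (lookup∘updateAt i (weight xs)) (cong suc (lookup-weight xs i))
... | no  i≢x  = trans (lookup∘updateAt′ i x i≢x (weight xs)) (lookup-weight xs i)

nth-all⁺ : ∀ {A : Set} {P : A → Set} xs → (∀ c y → nth xs c ≡ just y → P y) → All P xs
nth-all⁺ []       h = []
nth-all⁺ (x ∷ xs) h = h 0 x refl ∷ nth-all⁺ xs (λ c → h (suc c))

nth-all⁻ : ∀ {A : Set} {P : A → Set} {xs} → All P xs → ∀ c {y} → nth xs c ≡ just y → P y
nth-all⁻ (p ∷ ps) zero    refl = p
nth-all⁻ (p ∷ ps) (suc c) eq   = nth-all⁻ ps c eq

nth-sorted⁺ : (xs : List (Fin k)) →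
  (∀ c c′ x y → c < c′ → nth xs c ≡ just x → nth xs c′ ≡ just y → x Fin.≤ y) → Sorted xs
nth-sorted⁺ []       h = []
nth-sorted⁺ (x ∷ xs) h =
  nth-all⁺ xs (λ c y → h 0 (suc c) x y z<s refl) ∷
  nth-sorted⁺ xs (λ c c′ x y c<c′ → h (suc c) (suc c′) x y (s<s c<c′))

nth-sorted⁻ : {xs : List (Fin k)} → Sorted xs → ∀ c c′ x y → c < c′ →
  nth xs c ≡ just x → nth xs c′ ≡ just y → x Fin.≤ y
nth-sorted⁻ (x≤xs ∷ S) zero    (suc c′) x y _          refl eq′ = nth-all⁻ x≤xs c′ eq′
nth-sorted⁻ (x≤xs ∷ S) (suc c) (suc c′) x y (s≤s c<c′) eq   eq′ = nth-sorted⁻ S c c′ x y c<c′ eq eq′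

rowsSorted⁺ : (T : List (List (Fin k))) →
  (∀ r c c′ x y → c < c′ → entry T r c ≡ just x → entry T r c′ ≡ just y → x Fin.≤ y) →
  All Sorted T
rowsSorted⁺ []      h = []
rowsSorted⁺ (u ∷ T) h = nth-sorted⁺ u (h 0) ∷ rowsSorted⁺ T (λ r → h (suc r))

rowsSorted⁻ : {T : List (List (Fin k))} → All Sorted T →
  ∀ r c c′ x y → c < c′ → entry T r c ≡ just x → entry T r c′ ≡ just y → x Fin.≤ y
rowsSorted⁻ (S ∷ Ss) zero    = nth-sorted⁻ S
rowsSorted⁻ (S ∷ Ss) (suc r) = rowsSorted⁻ Ss r

nth-above⁺ : (u v : List (Fin k)) → length v ≤ length u →
  (∀ c x y → nth u c ≡ just x → nth v c ≡ just y → x Fin.< y) → Above u v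
nth-above⁺ u       []      _        h = tt
nth-above⁺ (x ∷ u) (y ∷ v) (s≤s le) h =
  h 0 x y refl refl , nth-above⁺ u v le (λ c → h (suc c))

nth-above⁻ : (u v : List (Fin k)) → Above u v →
  ∀ c x y → nth u c ≡ just x → nth v c ≡ just y → x Fin.< y
nth-above⁻ (x ∷ u) (y ∷ v) (lt , A) zero    _ _ refl refl = lt
nth-above⁻ (x ∷ u) (y ∷ v) (lt , A) (suc c) = nth-above⁻ u v A c

-- `Above` includes that the lower row is no longer than the upper one; this makes it transitive, so
-- `Tableau` can be stated for adjacent rows.
above-trans : {u v w : List (Fin k)} → Above u v → Above v w → Above u w
above-trans {w = []}                         _        _         = tt
above-trans {u = _ ∷ _} {_ ∷ _} {w = _ ∷ _} (lt , A) (lt′ , A′) = <-trans lt lt′ , above-trans A A′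

above-all⁺ : (u : List (Fin k)) (T : List (List (Fin k))) →
  All (_≤ length u) (List.map length T) →
  (∀ r c x y → nth u c ≡ just x → entry T r c ≡ just y → x Fin.< y) → All (Above u) T
above-all⁺ u []      _          h = []
above-all⁺ u (v ∷ T) (le ∷ les) h = nth-above⁺ u v le (h 0) ∷ above-all⁺ u T les (λ r → h (suc r))

above-all⁻ : (u : List (Fin k)) {T : List (List (Fin k))} → All (Above u) T →
  ∀ r c x y → nth u c ≡ just x → entry T r c ≡ just y → x Fin.< y
above-all⁻ u (A ∷ As) zero    = nth-above⁻ u _ A
above-all⁻ u (A ∷ As) (suc r) = above-all⁻ u As r

columnsStrict⁺ : (T : List (List (Fin k))) → AllPairs _≥_ (List.map length T) →
  (∀ r r′ c x y → r < r′ → entry T r c ≡ just x → entry T r′ c ≡ just y → x Fin.< y) →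
  AllPairs Above T
columnsStrict⁺ []      _          h = []
columnsStrict⁺ (u ∷ T) (les ∷ Ls) h =
  above-all⁺ u T les (λ r c x y → h 0 (suc r) c x y z<s) ∷
  columnsStrict⁺ T Ls (λ r r′ c x y r<r′ → h (suc r) (suc r′) c x y (s<s r<r′))

columnsStrict⁻ : {T : List (List (Fin k))} → AllPairs Above T →
  ∀ r r′ c x y → r < r′ → entry T r c ≡ just x → entry T r′ c ≡ just y → x Fin.< y
columnsStrict⁻ (A ∷ As) zero    (suc r′) c x y _          = above-all⁻ _ A r′ c x y
columnsStrict⁻ (A ∷ As) (suc r) (suc r′) c x y (s≤s r<r′) = columnsStrict⁻ As r r′ c x y r<r′

Tableau : List ℕ → Vec ℕ k → List (List (Fin k)) → Set
Tableau shape μ T =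
  List.map length T ≡ shape × All Sorted T × Linked Above T × weight (concat T) ≡ μ

-- `colStrict` speaks only of cells that exist, while `Above` also forbids a lower row longer than
-- the upper one. The decreasing shape supplies this comparison.
ssyt⇒tableau : ∀ {shape} {μ : Vec ℕ k} → Linked _≥_ shape →
  (T : SSYT shape μ) → Tableau shape μ (SSYT.rows T)
ssyt⇒tableau {shape = shape} dec T =
  hasShape ,
  rowsSorted⁺ rows rowWeak ,
  AllPairs⇒Linked (columnsStrict⁺ rows
    (subst (AllPairs _≥_) (sym hasShape) (Linked⇒AllPairs (λ p q → ≤-trans q p) dec)) colStrict) ,
  lookup-ext (λ i → trans (lookup-weight (concat rows) i) (content i))
  where open SSYT T

tableau⇒ssyt : ∀ {shape} {μ : Vec ℕ k} T → Tableau shape μ T → SSYT shape μ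
tableau⇒ssyt T (lengths , sorted , above , w) = record
  { rows      = T
  ; hasShape  = lengths
  ; rowWeak   = rowsSorted⁻ sorted
  ; colStrict = columnsStrict⁻ (Linked⇒AllPairs (λ {u} → above-trans {u = u}) above)
  ; content   = λ i → trans (sym (lookup-weight (concat T) i)) (cong (λ v → lookup v i) w)
  }

ssytToTableau : ∀ {shape} (μ : Vec ℕ k) → Linked _≥_ shape →
  PartialBijection (Image (SSYT.rows {shape = shape} {μ = μ})) (Tableau shape μ)
ssytToTableau μ dec = record
  { to      = λ T → T
  ; from    = λ T → T
  ; to-ok   = λ where (T , refl) → ssyt⇒tableau dec T
  ; from-ok = λ t → tableau⇒ssyt _ t , refl
  ; from-to = λ _ → refl
  ; to-from = λ _ → refl
  }

-- Tableaux as vectors of row weights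

pad : {A : Set} → A → ∀ m → List A → Vec A m
pad d zero    _        = []
pad d (suc m) []       = d ∷ pad d m []
pad d (suc m) (x ∷ xs) = x ∷ pad d m xs

pad-[] : ∀ m → pad 0 m [] ≡ zeros
pad-[] zero    = refl
pad-[] (suc m) = cong (0 ∷_) (pad-[] m)

rowWeights : ∀ m → List (List (Fin k)) → Vec (Vec ℕ k) m
rowWeights m T = map weight (pad [] m T)

-- The shape decides which of the zero rows of M are rows of the tableau.
tableauOf : List ℕ → Vec (Vec ℕ k) m → List (List (Fin k))
tableauOf []          M       = []
tableauOf (l ∷ shape) []      = []
tableauOf (l ∷ shape) (v ∷ M) = expand v ∷ tableauOf shape M

sum-rowWeights : ∀ m (T : List (List (Fin k))) →
  map sum (rowWeights m T) ≡ pad 0 m (List.map length T)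
sum-rowWeights         zero    T       = refl
sum-rowWeights {k = k} (suc m) []      = cong₂ _∷_ (sum-zeros k) (sum-rowWeights {k = k} m [])
sum-rowWeights         (suc m) (u ∷ T) = cong₂ _∷_ (sum-weight u) (sum-rowWeights m T)

columnSums-rowWeights : ∀ m (T : List (List (Fin k))) → length T ≤ m →
  columnSums (rowWeights m T) ≡ weight (concat T)
columnSums-rowWeights zero    []      _        = refl
columnSums-rowWeights (suc m) []      _        =
  trans (⊕-identityˡ _) (columnSums-rowWeights m [] z≤n)
columnSums-rowWeights (suc m) (u ∷ T) (s≤s le) =
  trans (cong (weight u ⊕_) (columnSums-rowWeights m T le)) (sym (weight-++ u (concat T)))

dominatesAll-rowWeights : ∀ m (T : List (List (Fin k))) → All Sorted T → Linked Above T →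
  DominatesAll zeros (rowWeights m T)
dominatesAll-rowWeights zero          T           _             _       = tt
dominatesAll-rowWeights (suc zero)    []          _             _       = tt
dominatesAll-rowWeights (suc zero)    (u ∷ T)     _             _       = tt
dominatesAll-rowWeights (suc (suc m)) []          _             _       =
  above⇒dominates [] [] [] [] tt , dominatesAll-rowWeights (suc m) [] [] []
dominatesAll-rowWeights (suc (suc m)) (u ∷ [])    (S ∷ _)       _       =
  above⇒dominates u [] S [] tt , dominatesAll-rowWeights (suc m) [] [] []
dominatesAll-rowWeights (suc (suc m)) (u ∷ v ∷ T) (S ∷ S′ ∷ Ss) (A ∷ L) =
  above⇒dominates u v S S′ A , dominatesAll-rowWeights (suc m) (v ∷ T) (S′ ∷ Ss) L

length-tableauOf : ∀ shape (M : Vec (Vec ℕ k) m) → length shape ≤ m →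
  map sum M ≡ pad 0 m shape → List.map length (tableauOf shape M) ≡ shape
length-tableauOf []          M       _        _  = refl
length-tableauOf (l ∷ shape) (v ∷ M) (s≤s le) eq =
  cong₂ _∷_ (trans (length-expand v) (∷-injectiveˡ eq)) (length-tableauOf shape M le (∷-injectiveʳ eq))

tableauOf-sorted : ∀ shape (M : Vec (Vec ℕ k) m) → All Sorted (tableauOf shape M)
tableauOf-sorted []          M       = []
tableauOf-sorted (l ∷ shape) []      = []
tableauOf-sorted (l ∷ shape) (v ∷ M) = expand-sorted v ∷ tableauOf-sorted shape M

tableauOf-above : ∀ shape (M : Vec (Vec ℕ k) m) → DominatesAll zeros M →
  Linked Above (tableauOf shape M)
tableauOf-above []               M           _        = []
tableauOf-above (l ∷ shape)      []          _        = []
tableauOf-above (l ∷ [])         (u ∷ M)     _        = [-]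
tableauOf-above (l ∷ l′ ∷ shape) (u ∷ [])    _        = [-]
tableauOf-above (l ∷ l′ ∷ shape) (u ∷ v ∷ M) (D , Ds) =
  dominates⇒above u v D ∷ tableauOf-above (l′ ∷ shape) (v ∷ M) Ds

tableauOf-rowWeights : ∀ m (T : List (List (Fin k))) → All Sorted T → length T ≤ m →
  tableauOf (List.map length T) (rowWeights m T) ≡ T
tableauOf-rowWeights m       []      _        _        = refl
tableauOf-rowWeights (suc m) (u ∷ T) (S ∷ Ss) (s≤s le) =
  cong₂ _∷_ (expand-weight u S) (tableauOf-rowWeights m T Ss le)

rowWeights-tableauOf : ∀ shape (M : Vec (Vec ℕ k) m) → map sum M ≡ pad 0 m shape →
  rowWeights m (tableauOf shape M) ≡ M
rowWeights-tableauOf []          []      _  = refl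
rowWeights-tableauOf []          (v ∷ M) eq =
  cong₂ _∷_ (sym (sum≡0⇒zeros v (∷-injectiveˡ eq))) (rowWeights-tableauOf [] M (∷-injectiveʳ eq))
rowWeights-tableauOf (l ∷ shape) []      _  = refl
rowWeights-tableauOf (l ∷ shape) (v ∷ M) eq =
  cong₂ _∷_ (weight-expand v) (rowWeights-tableauOf shape M (∷-injectiveʳ eq))

tableauToFilling : ∀ {shape} (μ : Vec ℕ k) → length shape ≤ m →
  PartialBijection (Tableau shape μ) (Filling zeros (pad 0 m shape) μ)
tableauToFilling {m = m} {shape} μ le = record
  { to      = rowWeights m
  ; from    = tableauOf shape
  ; to-ok   = λ {T} (lengths , S , A , w) →
      trans (⊕-identityˡ _) (trans (sum-rowWeights m T) (cong (pad 0 m) lengths)) ,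
      trans (columnSums-rowWeights m T (fits T lengths)) w ,
      dominatesAll-rowWeights m T S A
  ; from-ok = λ {M} (rows , columns , Ds) →
      let lengths = length-tableauOf shape M le (rowSums M rows) in
      lengths , tableauOf-sorted shape M , tableauOf-above shape M Ds ,
      trans (sym (columnSums-rowWeights m (tableauOf shape M) (fits (tableauOf shape M) lengths)))
        (trans (cong columnSums (rowWeights-tableauOf shape M (rowSums M rows))) columns)
  ; from-to = λ {T} (lengths , S , _) →
      trans (cong (λ z → tableauOf z (rowWeights m T)) (sym lengths))
        (tableauOf-rowWeights m T S (fits T lengths))
  ; to-from = λ {M} (rows , _) → rowWeights-tableauOf shape M (rowSums M rows)
  }
  where
  fits : ∀ {k} (T : List (List (Fin k))) → List.map length T ≡ shape → length T ≤ m
  fits T eq = subst (_≤ m) (trans (cong length (sym eq)) (List.length-map length T)) le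
  rowSums : ∀ {k} (M : Vec (Vec ℕ k) m) → zeros ⊕ map sum M ≡ pad 0 m shape → map sum M ≡ pad 0 m shape
  rowSums M rows = trans (sym (⊕-identityˡ _)) rows

ssytToChain : ∀ {shape} (μ : Vec ℕ k) → Linked _≥_ shape → length shape ≤ m →
  PartialBijection (Image (SSYT.rows {shape = shape} {μ = μ})) (ChainFrom0 μ (pad 0 m shape))
ssytToChain {m = m} {shape} μ dec le =
  ssytToTableau μ dec ⨾ tableauToFilling μ le ⨾ fillingToChain (pad 0 m shape) μ

-- Generalized permutations as matrices

-- The word is cut into blocks instead of being indexed by positions under `topRow α`, which fits
-- recursion on α.
BlockSorted : Vec ℕ n → List (Fin m) → Set
BlockSorted []      xs = xs ≡ []
BlockSorted (a ∷ α) xs =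
  ∃ λ ys → ∃ λ zs → xs ≡ ys List.++ zs × length ys ≡ a × Sorted ys × BlockSorted α zs

Word : Vec ℕ n → Vec ℕ m → List (Fin m) → Set
Word α β xs = BlockSorted α xs × weight xs ≡ β

BlocksIncrease : ∀ {s} → Vec (Fin n) s → Vec (Fin m) s → Set
BlocksIncrease t b =
  ∀ p q → p Fin.≤ q → lookup t p ≡ lookup t q → lookup b p Fin.≤ lookup b q

firstBlock⁻ : ∀ {s} (t : Vec (Fin n) s) (b₁ : Vec (Fin m) k) (b₂ : Vec (Fin m) s) →
  BlocksIncrease (replicate k zero ++ map suc t) (b₁ ++ b₂) →
  Sorted (toList b₁) × BlocksIncrease t b₂
firstBlock⁻ t []       b₂ h = [] , λ p q p≤q eq →
  h p q p≤q (trans (lookup-map p suc t) (trans (cong suc eq) (sym (lookup-map q suc t))))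
firstBlock⁻ t (x ∷ b₁) b₂ h with firstBlock⁻ t b₁ b₂ (λ p q p≤q → h (suc p) (suc q) (s≤s p≤q))
... | S , h′ = below t b₁ b₂ (λ q → h zero (suc q) z≤n) ∷ S , h′
  where
  below : ∀ {n k s m} {x : Fin m} (t : Vec (Fin n) s) (b₁ : Vec (Fin m) k) (b₂ : Vec (Fin m) s) →
    (∀ q → Fin.zero ≡ lookup (replicate k zero ++ map suc t) q → x Fin.≤ lookup (b₁ ++ b₂) q) →
    All (x Fin.≤_) (toList b₁)
  below t []       b₂ h = []
  below t (y ∷ b₁) b₂ h = h zero refl ∷ below t b₁ b₂ (λ q → h (suc q))

firstBlock⁺ : ∀ {s} (t : Vec (Fin n) s) (b₁ : Vec (Fin m) k) (b₂ : Vec (Fin m) s) →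
  Sorted (toList b₁) → BlocksIncrease t b₂ →
  BlocksIncrease (replicate k zero ++ map suc t) (b₁ ++ b₂)
firstBlock⁺ t [] b₂ _ h p q p≤q eq = h p q p≤q
  (Fin.suc-injective (trans (sym (lookup-map p suc t)) (trans eq (lookup-map q suc t))))
firstBlock⁺ t (x ∷ b₁) b₂ _          h zero    zero    _         _  = ≤-refl
firstBlock⁺ t (x ∷ b₁) b₂ (x≤b₁ ∷ _) h zero    (suc q) _         eq = below t b₁ b₂ x≤b₁ q eq
  where
  below : ∀ {n k s m} {x : Fin m} (t : Vec (Fin n) s) (b₁ : Vec (Fin m) k) (b₂ : Vec (Fin m) s) →
    All (x Fin.≤_) (toList b₁) →
    ∀ q → Fin.zero ≡ lookup (replicate k zero ++ map suc t) q → x Fin.≤ lookup (b₁ ++ b₂) q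
  below t []       b₂ _          q       eq with () ← trans eq (lookup-map q suc t)
  below t (y ∷ b₁) b₂ (x≤y ∷ _)  zero    eq = x≤y
  below t (y ∷ b₁) b₂ (_ ∷ x≤b₁) (suc q) eq = below t b₁ b₂ x≤b₁ q eq
firstBlock⁺ t (x ∷ b₁) b₂ (_ ∷ S)    h (suc p) (suc q) (s≤s p≤q) eq = firstBlock⁺ t b₁ b₂ S h p q p≤q eq

blockSorted⁺ : (α : Vec ℕ n) (b : Vec (Fin m) (sum α)) → BlocksIncrease (topRow α) b →
  BlockSorted α (toList b)
blockSorted⁺ []      []  h = refl
blockSorted⁺ (a ∷ α) b   h with splitAt a b
... | b₁ , b₂ , refl with firstBlock⁻ (topRow α) b₁ b₂ h
... | S , h′ = toList b₁ , toList b₂ , toList-++ b₁ b₂ , length-toList b₁ , S , blockSorted⁺ α b₂ h′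

blockSorted⁻ : (α : Vec ℕ n) (xs : List (Fin m)) → BlockSorted α xs →
  ∃ λ (b : Vec (Fin m) (sum α)) → toList b ≡ xs × BlocksIncrease (topRow α) b
blockSorted⁻ []      _ refl = [] , refl , λ ()
blockSorted⁻ (_ ∷ α) _ (ys , zs , refl , refl , S , B) with blockSorted⁻ α zs B
... | b , refl , h =
  fromList ys ++ b ,
  trans (toList-++ (fromList ys) b) (cong (List._++ toList b) (toList∘fromList ys)) ,
  firstBlock⁺ (topRow α) (fromList ys) b (subst Sorted (sym (toList∘fromList ys)) S) h

count-weight : ∀ {s} (b : Vec (Fin m) s) (j : Fin m) →
  count (j Fin.≟_) b ≡ lookup (weight (toList b)) j
count-weight b j = trans (count-filter b) (sym (lookup-weight (toList b) j))
  where
  count-filter : ∀ {s} (b : Vec _ s) → count (j Fin.≟_) b ≡ length (List.filter (j Fin.≟_) (toList b))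
  count-filter []      = refl
  count-filter (x ∷ b) with j Fin.≟ x
  ... | yes _ = cong suc (count-filter b)
  ... | no  _ = count-filter b

-- A list can be cut by `take` and `drop` without casts between lengths. At a fixed length `toList`
-- is injective, so the vector is still determined.
bottomWord : {α : Vec ℕ n} {β : Vec ℕ m} → GenPerm α β → List (Fin m)
bottomWord g = toList (GenPerm.bottom g)

genPermToWord : (α : Vec ℕ n) (β : Vec ℕ m) →
  PartialBijection (Image (bottomWord {α = α} {β})) (Word α β)
genPermToWord α β = record
  { to      = λ xs → xs
  ; from    = λ xs → xs
  ; to-ok   = λ where
      (genPerm b h c , refl) →
        blockSorted⁺ α b h , lookup-ext (λ j → trans (sym (count-weight b j)) (c j))
  ; from-ok = λ {xs} (B , w) → let (b , eq , h) = blockSorted⁻ α xs B in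
      genPerm b h (λ j → trans (count-weight b j) (cong (λ v → lookup v j) (trans (cong weight eq) w))) , eq
  ; from-to = λ _ → refl
  ; to-from = λ _ → refl
  }

blockWeights : Vec ℕ n → List (Fin m) → Vec (Vec ℕ m) n
blockWeights []      xs = []
blockWeights (a ∷ α) xs = weight (List.take a xs) ∷ blockWeights α (List.drop a xs)

expandRows : Vec (Vec ℕ m) n → List (Fin m)
expandRows []      = []
expandRows (v ∷ M) = expand v List.++ expandRows M

take-++ : {A : Set} (xs ys : List A) → List.take (length xs) (xs List.++ ys) ≡ xs
take-++ []       ys = refl
take-++ (x ∷ xs) ys = cong (x ∷_) (take-++ xs ys)

drop-++ : {A : Set} (xs ys : List A) → List.drop (length xs) (xs List.++ ys) ≡ ys
drop-++ []       ys = refl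
drop-++ (x ∷ xs) ys = drop-++ xs ys

blockWeights-ok : (α : Vec ℕ n) (xs : List (Fin m)) → BlockSorted α xs →
  map sum (blockWeights α xs) ≡ α × columnSums (blockWeights α xs) ≡ weight xs ×
  expandRows (blockWeights α xs) ≡ xs
blockWeights-ok []      _ refl = refl , refl , refl
blockWeights-ok (_ ∷ α) _ (ys , zs , refl , refl , S , B)
  rewrite take-++ ys zs | drop-++ ys zs with blockWeights-ok α zs B
... | rows , columns , eq =
  cong₂ _∷_ (sum-weight ys) rows ,
  trans (cong (weight ys ⊕_) columns) (sym (weight-++ ys zs)) ,
  cong₂ List._++_ (expand-weight ys S) eq

expandRows-ok : (M : Vec (Vec ℕ m) n) →
  BlockSorted (map sum M) (expandRows M) × weight (expandRows M) ≡ columnSums M ×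
  blockWeights (map sum M) (expandRows M) ≡ M
expandRows-ok []      = refl , refl , refl
expandRows-ok (v ∷ M) with expandRows-ok M
... | B , w , eq =
  (expand v , expandRows M , refl , length-expand v , expand-sorted v , B) ,
  trans (weight-++ (expand v) (expandRows M)) (cong₂ _⊕_ (weight-expand v) w) ,
  block
  where
  block : blockWeights (map sum (v ∷ M)) (expandRows (v ∷ M)) ≡ v ∷ M
  -- Replacing the row sum by the length of `expand v` puts the cut exactly at the seam of the
  -- concatenation.
  block rewrite sym (length-expand v)
              | take-++ (expand v) (expandRows M) | drop-++ (expand v) (expandRows M) =
    cong₂ _∷_ (weight-expand v) eq

wordToMatrix : (α : Vec ℕ n) (β : Vec ℕ m) → PartialBijection (Word α β) (MatrixOf α β)
wordToMatrix α β = record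
  { to      = blockWeights α
  ; from    = expandRows
  ; to-ok   = λ {xs} (B , w) → let (rows , columns , _) = blockWeights-ok α xs B in
      rows , trans columns w
  ; from-ok = from-ok _
  ; from-to = λ {xs} (B , _) → proj₂ (proj₂ (blockWeights-ok α xs B))
  ; to-from = to-from _
  }
  where
  from-ok : ∀ M → MatrixOf α β M → Word α β (expandRows M)
  from-ok M (refl , refl) = let (B , w , _) = expandRows-ok M in B , w
  to-from : ∀ M → MatrixOf α β M → blockWeights α (expandRows M) ≡ M
  to-from M (refl , _) = proj₂ (proj₂ (expandRows-ok M))

genPermToMatrix : (α : Vec ℕ n) (β : Vec ℕ m) →
  PartialBijection (Image (bottomWord {α = α} {β})) (MatrixOf α β)
genPermToMatrix α β = genPermToWord α β ⨾ wordToMatrix α β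

-- Reversing the columns of a matrix

sum-reverse : (v : Vec ℕ m) → sum (reverse v) ≡ sum v
sum-reverse []      = refl
sum-reverse (x ∷ v) rewrite reverse-∷ x v =
  trans (sum-∷ʳ (reverse v) x) (trans (+-comm _ x) (cong (x +_) (sum-reverse v)))
  where
  sum-∷ʳ : ∀ {m} (v : Vec ℕ m) x → sum (v ∷ʳ x) ≡ sum v + x
  sum-∷ʳ []      x = +-identityʳ x
  sum-∷ʳ (y ∷ v) x = trans (cong (y +_) (sum-∷ʳ v x)) (sym (+-assoc y (sum v) x))

reverse-zeros : ∀ m → reverse (zeros {m}) ≡ zeros
reverse-zeros zero    = refl
reverse-zeros (suc m) = trans (reverse-∷ 0 zeros) (trans (cong (_∷ʳ 0) (reverse-zeros m)) (zeros-∷ʳ m))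

reverse-⊕ : (u v : Vec ℕ m) → reverse (u ⊕ v) ≡ reverse u ⊕ reverse v
reverse-⊕ []      []      = refl
reverse-⊕ (x ∷ u) (y ∷ v)
  rewrite reverse-∷ (x + y) (u ⊕ v) | reverse-∷ x u | reverse-∷ y v | reverse-⊕ u v =
  ∷ʳ-⊕ (reverse u) (reverse v)
  where
  ∷ʳ-⊕ : ∀ {m} (u v : Vec ℕ m) → (u ⊕ v) ∷ʳ (x + y) ≡ (u ∷ʳ x) ⊕ (v ∷ʳ y)
  ∷ʳ-⊕ []      []      = refl
  ∷ʳ-⊕ (a ∷ u) (b ∷ v) = cong (a + b ∷_) (∷ʳ-⊕ u v)

columnSums-reverse : (M : Vec (Vec ℕ m) n) → columnSums (map reverse M) ≡ reverse (columnSums M)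
columnSums-reverse {m = m} []  = sym (reverse-zeros m)
columnSums-reverse     (v ∷ M) =
  trans (cong (reverse v ⊕_) (columnSums-reverse M)) (sym (reverse-⊕ v (columnSums M)))

-- Reading a pattern as a chain from the empty shape reverses its type. RSK applied to a matrix with
-- column sums `reverse β` therefore ends in a chain of type β.
reverseColumns : (α : Vec ℕ n) (β : Vec ℕ m) →
  PartialBijection (MatrixOf α β) (MatrixOf α (reverse β))
reverseColumns α β = record
  { to      = map reverse
  ; from    = map reverse
  ; to-ok   = λ {M} (rows , columns) →
      trans (row-sums M) rows , trans (columnSums-reverse M) (cong reverse columns)
  ; from-ok = λ {M} (rows , columns) →
      trans (row-sums M) rows ,
      trans (columnSums-reverse M) (trans (cong reverse columns) (reverse-involutive β))
  ; from-to = λ {M} _ → involutive M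
  ; to-from = λ {M} _ → involutive M
  }
  where
  row-sums : ∀ {m n} (M : Vec (Vec ℕ m) n) → map sum (map reverse M) ≡ map sum M
  row-sums M = trans (sym (map-∘ sum reverse M)) (map-cong sum-reverse M)
  involutive : ∀ {m n} (M : Vec (Vec ℕ m) n) → map reverse (map reverse M) ≡ M
  involutive M = trans (sym (map-∘ reverse reverse M)) (trans (map-cong reverse-involutive M) (map-id M))

-- Pairs of tableaux of the same shape

-- Cutting at the first zero removes nothing but zeros from a decreasing vector, and leaves the
-- positive parts that `Partition` demands.
trim : Vec ℕ m → List ℕ
trim []          = []
trim (zero ∷ _)  = []
trim (suc x ∷ v) = suc x ∷ trim v

Decreasing : Vec ℕ m → Set
Decreasing []      = ⊤
Decreasing (x ∷ v) = hd v ≤ x × Decreasing v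

strip-decreasing : (ls vs : Vec ℕ m) → Strip ls vs → Decreasing ls
strip-decreasing []       []       _               = tt
strip-decreasing (l ∷ ls) (v ∷ vs) (le , le′ , S) = ≤-trans le′ le , strip-decreasing ls vs S

zeros-decreasing : ∀ m → Decreasing (zeros {m})
zeros-decreasing m = strip-decreasing zeros zeros (zeros-strip m)

chain-decreasing : ∀ {α : Vec ℕ k} (cs : Vec (Vec ℕ m) k) {hi} → Chain α cs hi →
  Decreasing (bottomShape cs hi) → Decreasing hi
chain-decreasing {α = []}    []       _           dec = dec
chain-decreasing {α = _ ∷ _} (c ∷ cs) (S , _ , C) _   = chain-decreasing cs C (strip-decreasing _ c S)

chainFrom0-decreasing : ∀ {α : Vec ℕ k} (cs : Vec (Vec ℕ m) k) {hi} → ChainFrom0 α hi cs → Decreasing hi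
chainFrom0-decreasing {m = m} cs (b , C) =
  chain-decreasing cs C (subst Decreasing (sym b) (zeros-decreasing m))

decreasing-zeros : (v : Vec ℕ m) → Decreasing v → hd v ≡ 0 → v ≡ zeros
decreasing-zeros []      _         _    = refl
decreasing-zeros (_ ∷ v) (le , dec) refl = cong (0 ∷_) (decreasing-zeros v dec (n≤0⇒n≡0 le))

pad-trim : (v : Vec ℕ m) → Decreasing v → pad 0 m (trim v) ≡ v
pad-trim []                  _         = refl
pad-trim {suc m} (zero ∷ v)  (le , dec) =
  cong (0 ∷_) (trans (pad-[] m) (sym (decreasing-zeros v dec (n≤0⇒n≡0 le))))
pad-trim (suc x ∷ v)         (_ , dec) = cong (suc x ∷_) (pad-trim v dec)

trim-pad : ∀ m shape → All (0 <_) shape → length shape ≤ m → trim (pad 0 m shape) ≡ shape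
trim-pad zero    []              _       _        = refl
trim-pad (suc m) []              _       _        = refl
trim-pad (suc m) (suc l ∷ shape) (_ ∷ ps) (s≤s le) = cong (suc l ∷_) (trim-pad m shape ps le)

trim-positive : (v : Vec ℕ m) → All (0 <_) (trim v)
trim-positive []          = []
trim-positive (zero ∷ _)  = []
trim-positive (suc x ∷ v) = z<s ∷ trim-positive v

trim-linked : (v : Vec ℕ m) → Decreasing v → Linked _≥_ (trim v)
trim-linked []                  _          = []
trim-linked (zero ∷ _)          _          = []
trim-linked (suc x ∷ [])        _          = [-]
trim-linked (suc x ∷ zero ∷ _)  _          = [-]
trim-linked (suc x ∷ suc y ∷ v) (le , dec) = le ∷ trim-linked (suc y ∷ v) dec

trim-length : (v : Vec ℕ m) → length (trim v) ≤ m
trim-length []          = z≤n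
trim-length (zero ∷ _)  = z≤n
trim-length (suc x ∷ v) = s≤s (trim-length v)

trim-sum : (v : Vec ℕ m) → Decreasing v → ListAction.sum (trim v) ≡ sum v
trim-sum []                 _          = refl
trim-sum {suc m} (zero ∷ v) (le , dec) =
  sym (trans (cong sum (decreasing-zeros v dec (n≤0⇒n≡0 le))) (sum-zeros m))
trim-sum (suc x ∷ v)        (_ , dec)  = cong (suc x +_) (trim-sum v dec)

-- The first column of a tableau is strictly increasing in Fin k.
tableau-height : ∀ {shape} {μ : Vec ℕ k} T → All (0 <_) shape → Tableau shape μ T → length shape ≤ k
tableau-height []            _       (refl , _)         = z≤n
tableau-height (u ∷ T)       ps      (refl , _ , L , _) = column u T ps L
  where
  column : ∀ {k} (u : List (Fin k)) T → All (0 <_) (List.map length (u ∷ T)) → Linked Above (u ∷ T) →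
           suc (length (List.map length T)) ≤ k
  first : ∀ {k} x (u : List (Fin k)) T → All (0 <_) (List.map length T) → Linked Above ((x ∷ u) ∷ T) →
          Fin.toℕ x + suc (length (List.map length T)) ≤ k
  first x u []            _        _             = ≤-trans (≤-reflexive (+-comm (Fin.toℕ x) 1)) (Fin.toℕ<n x)
  first x u ((y ∷ v) ∷ T) (_ ∷ ps) ((x<y , _) ∷ L) =
    ≤-trans (≤-reflexive (+-suc (Fin.toℕ x) _)) (≤-trans (+-monoˡ-≤ _ x<y) (first y v T ps L))
  column (x ∷ u) T (_ ∷ ps) L = ≤-trans (m≤n+m _ (Fin.toℕ x)) (first x u T ps L)

module _ {N : ℕ} (α : Vec ℕ n) (β : Vec ℕ m) (|α| : sum α ≡ N) where

  private
    module T {shape} (dec : Linked _≥_ shape) (le : length shape ≤ m) =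
      PartialBijection (ssytToChain {shape = shape} α dec le)
    module U {shape} (dec : Linked _≥_ shape) (le : length shape ≤ m) =
      PartialBijection (ssytToChain {shape = shape} β dec le)

    -- `tableauFrom` and `chainTo` are the two maps of `ssytToChain` without its proofs about the
    -- shape: `toPair` and `fromPair` act on raw data, where no such proofs are at hand.
    tableauFrom : ∀ {k} → List ℕ → Vec (Vec ℕ m) k → List (List (Fin k))
    tableauFrom shape cs = tableauOf shape (stepsOf cs (pad 0 m shape))

    chainTo : ∀ {k} → List (List (Fin k)) → Vec (Vec ℕ m) k
    chainTo T = chainOf zeros (rowWeights m T)

    -- The bound comes from the tableau of type β, whose letters lie in `Fin m`; it then holds for
    -- the other tableau too, since the shape is shared.
    height : (K : KostkaPairs N α β) → length (Partition.parts (proj₁ K)) ≤ m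
    height (p , _ , U) =
      tableau-height (SSYT.rows U) (Partition.positive p) (ssyt⇒tableau (Partition.decreasing p) U)

    toPair : Vec ℕ m × Vec (Vec ℕ m) n × Vec (Vec ℕ m) m →
             List ℕ × List (List (Fin n)) × List (List (Fin m))
    toPair (hi , cs , ds) = trim hi , tableauFrom (trim hi) cs , tableauFrom (trim hi) ds

    fromPair : List ℕ × List (List (Fin n)) × List (List (Fin m)) →
               Vec ℕ m × Vec (Vec ℕ m) n × Vec (Vec ℕ m) m
    fromPair (shape , T , U) = pad 0 m shape , chainTo T , chainTo U

    module Shape (hi : Vec ℕ m) (cs : Vec (Vec ℕ m) n) (ds : Vec (Vec ℕ m) m)
                 (C : ChainFrom0 α hi cs) (D : ChainFrom0 β hi ds) where
      decreasing : Decreasing hi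
      decreasing = chainFrom0-decreasing cs C
      dec = trim-linked hi decreasing
      le  = trim-length hi
      padded = pad-trim hi decreasing
      C′ = subst (λ z → ChainFrom0 α z cs) (sym padded) C
      D′ = subst (λ z → ChainFrom0 β z ds) (sym padded) D
      shape : Partition N
      shape = partition (trim hi) (trim-positive hi) dec
        (trans (trim-sum hi decreasing) (trans (chainFrom0-sum cs C) |α|))

  chainPairToKostka : PartialBijection (ChainPair α β) (Image (kostkaPairsData {N = N} {α} {β}))
  chainPairToKostka = record
    { to      = toPair
    ; from    = fromPair
    ; to-ok   = λ {(hi , cs , ds)} (C , D) →
        let open Shape hi cs ds C D
            (T , T≡) = T.from-ok dec le C′
            (U , U≡) = U.from-ok dec le D′
        in (shape , T , U) , cong₂ (λ x y → trim hi , x , y) T≡ U≡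
    ; from-ok = λ where
        (K@(p , T , U) , refl) →
          T.to-ok (Partition.decreasing p) (height K) (T , refl) ,
          U.to-ok (Partition.decreasing p) (height K) (U , refl)
    ; from-to = λ {(hi , cs , ds)} (C , D) →
        let open Shape hi cs ds C D
        in cong₂ _,_ padded (cong₂ _,_ (T.to-from dec le C′) (U.to-from dec le D′))
    ; to-from = λ where
        (K@(p , T , U) , refl) → to-from p T U (height K)
    }
    where
    to-from : ∀ p T U → length (Partition.parts p) ≤ m →
      let K = kostkaPairsData {N = N} {α} {β} (p , T , U) in toPair (fromPair K) ≡ K
    to-from p T U le
      rewrite trim-pad m (Partition.parts p) (Partition.positive p) le =
      cong₂ (λ x y → Partition.parts p , x , y)
        (T.from-to (Partition.decreasing p) le (T , refl))
        (U.from-to (Partition.decreasing p) le (U , refl))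

-- Composition of the bijections

genPermToRectangle : ∀ N (α : Vec ℕ n) (β : Vec ℕ m) → sum α ≡ N → sum β ≡ N →
  PartialBijection (Image (bottomWord {α = α} {β}))
                   (Image (SSYT.rows {shape = rect N m} {μ = α ++ map (N ∸_) β}))
genPermToRectangle {m = m} N α β |α| |β| =
  genPermToMatrix α β ⨾ rsk α β ⨾ rectangle α β |α| |β| ⨾ converse tableaux
  where
  open Rectangle N
  rect-decreasing : ∀ m → Linked _≥_ (rect N m)
  rect-decreasing zero          = []
  rect-decreasing (suc zero)    = [-]
  rect-decreasing (suc (suc m)) = ≤-refl ∷ rect-decreasing (suc m)
  pad-rect : ∀ m → pad 0 m (rect N m) ≡ full m
  pad-rect zero    = refl
  pad-rect (suc m) = cong (N ∷_) (pad-rect m)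
  μ = α ++ map (N ∸_) β
  tableaux : PartialBijection (Image (SSYT.rows {shape = rect N m} {μ = μ})) (ChainFrom0 μ (full m))
  tableaux = subst (λ hi → PartialBijection (Image (SSYT.rows {shape = rect N m} {μ = μ})) (ChainFrom0 μ hi))
    (pad-rect m)
    (ssytToChain μ (rect-decreasing m) (≤-reflexive (List.length-replicate m)))

genPermToKostka : ∀ N (α : Vec ℕ n) (β : Vec ℕ m) → sum α ≡ N →
  PartialBijection (Image (bottomWord {α = α} {β})) (Image (kostkaPairsData {N = N} {α} {β}))
genPermToKostka N α β |α| =
  genPermToMatrix α β ⨾ reverseColumns α β ⨾ rsk α (reverse β) ⨾
  subst (λ γ → PartialBijection (ChainPattern α (reverse β)) (ChainPair α γ)) (reverse-involutive β)
    (patternToChain α (reverse β)) ⨾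
  chainPairToKostka α β |α|

-- The maps are built from the chosen preimages, but the keys of their values are given by `to` and
-- `from`, so the setoid laws reduce to the round trips of `f`. Injectivity of `i` turns equality of
-- the keys seen by `f` into the equality compared on the left.
imagesInverse : ∀ {X Y A A′ B : Set} (k : X → A) (i : A → A′) (l : Y → B) →
  (∀ {a b} → i a ≡ i b → a ≡ b) → PartialBijection (Image (λ x → i (k x))) (Image l) →
  Inverse (On.setoid {B = X} (≡.setoid A) k) (On.setoid {B = Y} (≡.setoid B) l)
imagesInverse k i l injective f = record
  { to        = TO
  ; from      = FROM
  ; to-cong   = λ {x} {x′} eq → trans (TO-key x) (trans (cong (λ a → to (i a)) eq) (sym (TO-key x′)))
  ; from-cong = λ {y} {y′} eq → injective (trans (FROM-key y) (trans (cong from eq) (sym (FROM-key y′))))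
  ; inverse   =
      (λ {y} {x} eq → trans (TO-key x)
        (trans (cong to (trans (cong i eq) (FROM-key y))) (to-from (y , refl)))) ,
      (λ {x} {y} eq → injective (trans (FROM-key y)
        (trans (cong from (trans eq (TO-key x))) (from-to (x , refl)))))
  }
  where
  open PartialBijection f
  TO = λ x → proj₁ (to-ok (x , refl))
  FROM = λ y → proj₁ (from-ok (y , refl))
  TO-key : ∀ x → l (TO x) ≡ to (i (k x))
  TO-key x = proj₂ (to-ok (x , refl))
  FROM-key : ∀ y → i (k (FROM y)) ≡ from (l y)
  FROM-key y = proj₂ (from-ok (y , refl))

theorem1p5 : (N n m : ℕ) (α : Vec ℕ n) (β : Vec ℕ m) → sum α ≡ N → sum β ≡ N →
    Inverse (GenPermSetoid α β) (SSYTSetoid (rect N m) (α ++ map (N ∸_) β))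
    × Inverse (GenPermSetoid α β) (KostkaPairsSetoid N α β)
theorem1p5 N n m α β |α| |β| =
  imagesInverse GenPerm.bottom toList SSYT.rows toList-inj (genPermToRectangle N α β |α| |β|) ,
  imagesInverse GenPerm.bottom toList kostkaPairsData toList-inj (genPermToKostka N α β |α|)
  where
  toList-inj : ∀ {A : Set} {n} {xs ys : Vec A n} → toList xs ≡ toList ys → xs ≡ ys
  toList-inj {xs = xs} {ys} eq = trans (sym (cast-is-id refl xs)) (toList-injective refl xs ys eq)
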